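{- Let $G$ be a finite simple cubic planar graph, embedded in the plane so that its outer face is bounded by a cycle, and let $\overline{G}$ be its dual graph, with outer vertex $\overline{v}^*$. Then $G$ has a Hamiltonian cycle if and only if there exists a tree $\overline{T}$ in $\overline{G}$ found by the Expansion Algorithm (that is, the tree $\overline{T}$ associated with some run of the Expansion Algorithm on $G$), with root $\overline{v}^*$, satisfying the following two properties: (1) For each vertex $v$ of $G$, if $v$ lies on the boundaries of the faces $f_{\overline{v}_1}, f_{\overline{v}_2}, f_{\overline{v}_3}$, then at least one of the vertices $\overline{v}_1,\overline{v}_2,\overline{v}_3$ of $\overline{G}$ lies on $\overline{T}$. (2) No two vertices on $\overline{T}$ are joined by an edge $\overline{e}$ of $\overline{G}$ unless $\overline{e}\in\overline{T}$.
   Context: Complementary path: for a cycle $\sigma$ in a plane graph $G$ and an edge $e=v_1v_2$ of $\sigma$, a complementary path $P_e^\sigma$ is a path in $G$ from $v_1$ to $v_2$ that is internally disjoint from $\sigma$ and such that $P_e^\sigma$ together with $e$ forms the boundary of a face of $G$. Sum of graphs: $(V_1,E_1)+(V_2,E_2):=(V_1\cup V_2,E_1\cup E_2)$; "$-e$" means deleting the edge $e$ (but no vertices). Expansion Algorithm: let $\sigma_0$ be the outer facial cycle of $G$ and $i=0$. As long as there is an edge $e_i\in\sigma_i$ for which a complementary path $P_{e_i}^{\sigma_i}$ exists, choose such an edge $e_i$, put $\sigma_{i+1}:=\sigma_i+P_{e_i}^{\sigma_i}-e_i$, and increase $i$ by one. When no such edge exists, output $\sigma_i$. The choices of the $e_i$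 are arbitrary, so different runs are possible. Dual graph: $\overline{G}=(\overline{V},\overline{E})$ has one vertex $\overline{v}$ for each face of $G$; the face corresponding to $\overline{v}$ is denoted $f_{\overline{v}}$. Each edge $e$ of $G$ that is a shared boundary edge of $f_{\overline{v}_1}$ and $f_{\overline{v}_2}$ gives a dual edge $\overline{e}$ between $\overline{v}_1$ and $\overline{v}_2$ (so parallel edges may occur in $\overline{G}$). The outer vertex $\overline{v}^*$ is the vertex of $\overline{G}$ corresponding to the outer face of $G$. Tree associated with a run: if $e_0,e_1,\dots,e_n$ are the edges chosen, in order, in a run of the Expansion Algorithm, then $\overline{T}=\bigcup_{i=0}^n\overline{e}_i$ is the subgraph of $\overline{G}$ formed by the dual edges and their end vertices; it starts from the root $\overline{v}^*$ (and is the single vertex $\overline{v}^*$ if no edge is chosen). -}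

module Defs where

open import Data.Fin.Base using (Fin)
open import Data.Fin.Properties using (_<?_)
open import Data.List.Base using (List; []; _∷_; _∷ʳ_; length; map; filter; zip; drop; allFin; cartesianProduct)
open import Data.List.Membership.Propositional using () renaming (_∈_ to _∈ₗ_)
open import Data.List.Relation.Unary.All using (All)
open import Data.List.Relation.Unary.AllPairs using (AllPairs)
open import Data.List.Relation.Unary.Any using (Any)
open import Data.List.Relation.Unary.Linked using (Linked)
open import Data.List.Relation.Unary.Unique.Propositional using (Unique)
open import Data.Nat.Base using (ℕ; _+_; _≤_)
open import Data.Nat.GeneralisedArithmetic using (fold)
open import Data.Product.Base using (Σ; ∃; _×_; _,_; swap)
open import Data.Sum.Base using (_⊎_)
open import Function.Bundles using (_⇔_)
open import Level using (0ℓ)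
open import Relation.Binary.Construct.Closure.ReflexiveTransitive using (Star)
open import Relation.Binary.Core using (Rel)
open import Relation.Binary.Definitions using (Decidable; Symmetric; Irreflexive)
open import Relation.Binary.PropositionalEquality.Core using (_≡_)
open import Relation.Nullary.Decidable using (_×-dec_)
open import Relation.Nullary.Negation using (¬_)
open import Relation.Unary using (Pred; _∈_; _∉_; _∪_; _≐_)

record SimpleGraph : Set₁ where
  field
    order : ℕ

  Vertex : Set
  Vertex = Fin order

  field
    Adj        : Rel Vertex 0ℓ
    Adj?       : Decidable Adj
    Adj-sym    : Symmetric Adj
    Adj-irrefl : Irreflexive _≡_ Adj

  degree : Vertex → ℕ
  degree v = length (filter (Adj? v) (allFin order))

  size : ℕ
  size = length (filter (λ { (u , v) → (u <? v) ×-dec Adj? u v })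
                        (cartesianProduct (allFin order) (allFin order)))

  Cubic : Set
  Cubic = ∀ v → degree v ≡ 3

  -- The dart (u , v) is the edge uv traversed from u to v; an undirected edge
  -- is represented by either of its two darts.
  Dart : Set
  Dart = Vertex × Vertex

  SameEdge : Rel Dart 0ℓ
  SameEdge d e = d ≡ e ⊎ d ≡ swap e

  record Subgraph : Set₁ where
    field
      vertices : Pred Vertex 0ℓ
      edges    : Pred Dart 0ℓ

  open Subgraph public

  infix  4 _≋_
  infixl 6 _⊞_ _⊟_

  _≋_ : Subgraph → Subgraph → Set
  S ≋ S′ = (vertices S ≐ vertices S′) × (edges S ≐ edges S′)

  _⊞_ : Subgraph → Subgraph → Subgraph
  S ⊞ S′ = record { vertices = vertices S ∪ vertices S′ ; edges = edges S ∪ edges S′ }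

  _⊟_ : Subgraph → Dart → Subgraph
  S ⊟ e = record { vertices = vertices S ; edges = λ d → d ∈ edges S × ¬ SameEdge d e }

  walkGraph : List Vertex → Subgraph
  walkGraph vs = record
    { vertices = λ v → v ∈ₗ vs
    ; edges    = λ d → Any (SameEdge d) (zip vs (drop 1 vs))
    }

  edgeGraph : Dart → Subgraph
  edgeGraph (u , v) = walkGraph (u ∷ v ∷ [])

  record Cycle : Set where
    field
      base     : Vertex
      others   : List Vertex
      long     : 2 ≤ length others
      distinct : Unique (base ∷ others)
      linked   : Linked Adj (base ∷ others ∷ʳ base)

  cycleGraph : Cycle → Subgraph
  cycleGraph C = walkGraph (base ∷ others ∷ʳ base)
    where open Cycle C

  IsHamiltonian : Cycle → Set
  IsHamiltonian C = ∀ v → v ∈ vertices (cycleGraph C)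

  HasHamiltonianCycle : Set
  HasHamiltonianCycle = ∃ IsHamiltonian

-- A plane graph, up to homeomorphism of the plane, as a rotation system with
-- labelled faces and a distinguished outer face.  The graph may be
-- disconnected, in which case a face may be bounded by several closed walks
-- (several orbits of the face-tracing map receive the same label).  `linked`
-- says that the bipartite incidence graph between components and faces is
-- connected; given this, Euler's formula for a graph with C components,
-- V + F = E + C + 1, holds exactly when every component has genus 0 and that
-- incidence graph is a tree, i.e. when the data come from a plane drawing.
-- (A graph with isolated vertices has no such data.)
record PlaneEmbedding (G : SimpleGraph) : Set where
  open SimpleGraph G
  field
    -- rot v u is the neighbour of v following u in clockwise order around v;
    -- its value is irrelevant when u is not a neighbour of v.
    rot        : Vertex → Vertex → Vertex
    rot-adj    : ∀ {v u} → Adj v u → Adj v (rot v u)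
    rot-cyclic : ∀ {v u w} → Adj v u → Adj v w → ∃ λ k → fold u (rot v) k ≡ w

    -- left (u , v) is the face to the left when going from u to v; its value
    -- is irrelevant when uv is not an edge.
    faces      : ℕ
    left       : Dart → Fin faces
    left-trace : ∀ {u v} → Adj u v → left (u , v) ≡ left (v , rot v u)
    left-onto  : ∀ φ → ∃ λ u → ∃ λ v → Adj u v × left (u , v) ≡ φ

    outer : Fin faces

  Face : Set
  Face = Fin faces

  -- As w ranges over the neighbours of v, left (v , w) ranges over the faces
  -- at the corners of v.
  boundary : Face → Subgraph
  boundary φ = record
    { vertices = λ v → ∃ λ w → Adj v w × left (v , w) ≡ φ
    ; edges    = λ { (u , v) → Adj u v × (left (u , v) ≡ φ ⊎ left (v , u) ≡ φ) }
    }

  SharesFace : Rel Vertex 0ℓ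
  SharesFace u v = ∃ λ φ → u ∈ vertices (boundary φ) × v ∈ vertices (boundary φ)

  field
    linked : ∀ u v → Star (λ x y → Adj x y ⊎ SharesFace x y) u v

    components     : ℕ
    component      : Vertex → Fin components
    component-onto : ∀ c → ∃ λ v → component v ≡ c
    component-≡    : ∀ u v → component u ≡ component v ⇔ Star Adj u v

    euler : order + faces ≡ size + components + 1

module _ {G : SimpleGraph} (Γ : PlaneEmbedding G) where
  open SimpleGraph G
  open PlaneEmbedding Γ

  BoundedByCycle : Face → Set
  BoundedByCycle φ = Σ Cycle λ C → boundary φ ≋ cycleGraph C

  pathVertices : Dart → List Vertex → List Vertex
  pathVertices (v₁ , v₂) interior = v₁ ∷ interior ∷ʳ v₂

  record ComplementaryPath (σ : Subgraph) (e : Dart) : Set where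
    field
      interior            : List Vertex
      path-linked         : Linked Adj (pathVertices e interior)
      path-distinct       : Unique (pathVertices e interior)
      internally-disjoint : All (_∉ vertices σ) interior
      face                : Face
      bounds              : boundary face ≋ walkGraph (pathVertices e interior) ⊞ edgeGraph e

    path : Subgraph
    path = walkGraph (pathVertices e interior)

  -- The remainder of a run once the current subgraph is σ.
  data RunFrom (σ : Subgraph) : Set where
    stop : (∀ e → e ∈ edges σ → ¬ ComplementaryPath σ e) → RunFrom σ
    step : ∀ e → e ∈ edges σ → (P : ComplementaryPath σ e) →
           RunFrom (σ ⊞ ComplementaryPath.path P ⊟ e) → RunFrom σ

  Run : Set
  Run = RunFrom (boundary outer)

  chosen : ∀ {σ} → RunFrom σ → List Dart
  chosen (stop _)       = []
  chosen (step e _ _ r) = e ∷ chosen r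

  -- The dual graph has the faces as its vertices and, identified with the
  -- edges of G, one edge between left e and right e for each edge e of G.
  right : Dart → Face
  right e = left (swap e)

  record DualSubgraph : Set₁ where
    field
      dualVertices : Pred Face 0ℓ
      dualEdges    : Pred Dart 0ℓ

  open DualSubgraph public

  DualConnected : DualSubgraph → Set
  DualConnected T = ∀ {φ ψ} → φ ∈ dualVertices T → ψ ∈ dualVertices T →
    Star (λ x y → ∃ λ e → e ∈ dualEdges T × left e ≡ x × right e ≡ y) φ ψ

  -- Loops and pairs of parallel edges count as cycles of the multigraph.
  record DualCycle (T : DualSubgraph) : Set where
    field
      first          : Dart
      others         : List Dart
      inside         : All (_∈ dualEdges T) (first ∷ others)
      consecutive    : Linked (λ d e → right d ≡ left e) (first ∷ others ∷ʳ first)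
      edges-distinct : AllPairs (λ d e → ¬ SameEdge d e) (first ∷ others)
      faces-distinct : Unique (map left (first ∷ others))

  IsTreeRootedAt : Face → DualSubgraph → Set
  IsTreeRootedAt φ T = φ ∈ dualVertices T × DualConnected T × ¬ DualCycle T

  runTree : Run → DualSubgraph
  runTree r = record
    { dualVertices = λ φ → φ ≡ outer ⊎ Any (λ e → φ ≡ left e ⊎ φ ≡ right e) (chosen r)
    ; dualEdges    = λ d → Any (SameEdge d) (chosen r)
    }

  -- φ₁, φ₂, φ₃ are the faces around a vertex of a cubic graph; they need not be
  -- distinct, since a face can occur at several corners of the same vertex.
  MeetsEveryVertex : DualSubgraph → Set
  MeetsEveryVertex T = ∀ v φ₁ φ₂ φ₃ →
    (∀ φ → v ∈ vertices (boundary φ) ⇔ φ ∈ₗ (φ₁ ∷ φ₂ ∷ φ₃ ∷ [])) →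
    φ₁ ∈ dualVertices T ⊎ φ₂ ∈ dualVertices T ⊎ φ₃ ∈ dualVertices T

  IsInduced : DualSubgraph → Set
  IsInduced T = ∀ φ ψ → ¬ φ ≡ ψ → φ ∈ dualVertices T → ψ ∈ dualVertices T →
    ∀ u v → Adj u v → left (u , v) ≡ φ → right (u , v) ≡ ψ → (u , v) ∈ dualEdges T

{-# OPTIONS --safe #-}

-- For a run, the current subgraph σ stays a cycle and contains all vertices of every visited face: a complementary
-- path has an interior vertex, since a cubic graph has no face with a single edge, so the face it bounds is new.
-- Hence property (1) makes the final cycle Hamiltonian.
--
-- Conversely, let H be a Hamiltonian cycle, and call the other edges chords. Walking along H, the faces to the left
-- of H are joined to each other by dual edges of chords, and so are those to the right, so the chords leave at most two
-- components of faces. By Euler's formula there are at least |chords| + 2 faces; as a graph with k components on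
-- n vertices has at least n − k edges, the two sides of H are distinct components and both are trees. The same count
-- for the orbits of the face-tracing map shows that each face is a single closed walk, and as no edge has
-- the same face on both sides, this walk is a cycle. Exploring the tree of the component of the outer face is a run: if
-- an unvisited face met σ away from the chord that attaches it, then a second chord would close a cycle in the tree.
module Submission where

open import Defs
open import Data.Empty using (⊥; ⊥-elim)
open import Data.Fin.Base as Fin using (Fin; zero; suc)
open import Data.Fin.Properties using (_≟_; _<?_; any?; <-cmp)
open import Data.List.Base using (List; []; _∷_; _++_; _∷ʳ_; length; map; filter; zip; drop; allFin; cartesianProduct; reverse)
open import Data.List.Properties using (length-map; length-++; length-tabulate; filter-notAll;
  ++-assoc; ++-identityʳ; ∷ʳ-++; unfold-reverse;
  reverse-++; reverse-involutive; map-++; ∷ʳ-injective; ∷-injective)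
open import Data.List.Membership.Propositional using () renaming (_∈_ to _∈ₗ_; _∉_ to _∉ₗ_)
open import Data.List.Membership.Propositional.Properties
open import Data.List.Relation.Binary.Permutation.Propositional using (_↭_; ↭⇒↭ₛ; ↭-sym)
open import Data.List.Relation.Binary.Permutation.Propositional.Properties using (++-comm; ↭-reverse; ∈-resp-↭)
import Data.List.Relation.Binary.Permutation.Setoid.Properties as Permutationₛ
open import Data.List.Relation.Unary.All as All using (All; []; _∷_)
open import Data.List.Relation.Unary.AllPairs as AllPairs using (AllPairs; []; _∷_)
open import Data.List.Relation.Unary.Any as Any using (Any; here; there)
import Data.List.Relation.Unary.Any.Properties as Any
open import Data.List.Relation.Unary.Linked as Linked using (Linked; []; [-]; _∷_)
open import Data.List.Relation.Unary.Unique.Propositional using (Unique)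
import Data.List.Relation.Unary.Unique.Propositional.Properties as Unique
open import Data.Nat.Base using (ℕ; zero; suc; _+_; _≤_; _<_; z≤n; s≤s)
open import Data.Nat.GeneralisedArithmetic using (fold)
import Data.Nat.Properties as ℕ
open import Data.Product.Base using (Σ; ∃; ∃₂; _×_; _,_; proj₁; proj₂; swap)
open import Data.Product.Properties using (≡-dec)
open import Data.Sum.Base using (_⊎_; inj₁; inj₂; [_,_]′) renaming (swap to ⊎-swap; map to ⊎-map)
open import Function.Base using (_∘_; id; case_of_)
open import Function.Bundles using (_⇔_; mk⇔; Equivalence)
open import Relation.Binary.Construct.Closure.ReflexiveTransitive as Star using (Star; ε; _◅_; _◅◅_)
open import Relation.Binary.Core using (Rel)
open import Relation.Binary.Definitions using (Symmetric; tri<; tri≈; tri>) renaming (Decidable to Decidable₂)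
open import Relation.Binary.PropositionalEquality using (_≡_; _≢_; refl; sym; trans; cong; cong₂;
  subst; subst₂; setoid; module ≡-Reasoning)
open import Relation.Nullary using (yes; no; ¬_)
open import Relation.Nullary.Decidable using (_×-dec_; _⊎-dec_; ¬?; decidable-stable)
open import Relation.Unary using (Pred; Decidable; _∈_; _∉_)
open import Level using (0ℓ)

-- Lists: distinct entries and consecutive pairs

private variable
  A B : Set

unique-⊆⇒length≤ : {xs ys : List A} → Unique xs → (∀ {x} → x ∈ₗ xs → x ∈ₗ ys) →
                   length xs ≤ length ys
unique-⊆⇒length≤ [] sub = z≤n
unique-⊆⇒length≤ {xs = x ∷ xs} (x≢ ∷ uxs) sub with ∈-∃++ (sub (here refl))
... | as , bs , refl = begin
  suc (length xs)            ≤⟨ s≤s (unique-⊆⇒length≤ uxs sub′) ⟩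
  suc (length (as ++ bs))    ≡⟨ cong suc (length-++ as) ⟩
  suc (length as + length bs) ≡⟨ ℕ.+-suc (length as) (length bs) ⟨
  length as + suc (length bs) ≡⟨ length-++ as ⟨
  length (as ++ x ∷ bs)      ∎
  where
  open ℕ.≤-Reasoning
  sub′ : ∀ {y} → y ∈ₗ xs → y ∈ₗ as ++ bs
  sub′ y∈ with ∈-++⁻ as (sub (there y∈))
  ... | inj₁ y∈as = ∈-++⁺ˡ y∈as
  ... | inj₂ (here refl) = ⊥-elim (All.lookup x≢ y∈ refl)
  ... | inj₂ (there y∈bs) = ∈-++⁺ʳ as y∈bs

unique-resp-↭ : {xs ys : List A} → xs ↭ ys → Unique xs → Unique ys
unique-resp-↭ p = Permutationₛ.Unique-resp-↭ (setoid _) (↭⇒↭ₛ p)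

unique-∉ : {x : A} {xs : List A} → Unique (x ∷ xs) → x ∉ₗ xs
unique-∉ (x≢ ∷ _) x∈ = All.lookup x≢ x∈ refl

unique-∷ : {x : A} {xs : List A} → x ∉ₗ xs → Unique xs → Unique (x ∷ xs)
unique-∷ x∉ u = All.tabulate (λ {y} y∈ x≡y → x∉ (subst (_∈ₗ _) (sym x≡y) y∈)) ∷ u

∈-resp-≡ : {x : A} {xs ys : List A} → xs ≡ ys → x ∈ₗ xs → x ∈ₗ ys
∈-resp-≡ refl x∈ = x∈

map-injective⁻ : (f : A → B) {xs : List A} → Unique (map f xs) →
                 ∀ {x y} → x ∈ₗ xs → y ∈ₗ xs → f x ≡ f y → x ≡ y
map-injective⁻ f u (here refl) (here refl) e = refl
map-injective⁻ f (x≢ ∷ _) (here refl) (there y∈) e = ⊥-elim (All.lookup x≢ (∈-map⁺ f y∈) e)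
map-injective⁻ f (x≢ ∷ _) (there x∈) (here refl) e = ⊥-elim (All.lookup x≢ (∈-map⁺ f x∈) (sym e))
map-injective⁻ f (_ ∷ u) (there x∈) (there y∈) e = map-injective⁻ f u x∈ y∈ e

map-unique⁺ : (f : A → B) {xs : List A} →
              (∀ {x y} → x ∈ₗ xs → y ∈ₗ xs → f x ≡ f y → x ≡ y) → Unique xs → Unique (map f xs)
map-unique⁺ f inj [] = []
map-unique⁺ f inj (x≢ ∷ u) =
  unique-∷ (λ fx∈ → case ∈-map⁻ f fx∈ of λ { (y , y∈ , e) → All.lookup x≢ y∈ (inj (here refl) (there y∈) e) })
           (map-unique⁺ f (λ x∈ y∈ → inj (there x∈) (there y∈)) u)

-- The darts of a walk in order; this is by definition the list from which `walkGraph` takes its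
-- edges.
pairs : List A → List (A × A)
pairs xs = zip xs (drop 1 xs)

pairs-++ : ∀ (xs : List A) y ys → pairs (xs ++ y ∷ ys) ≡ pairs (xs ∷ʳ y) ++ pairs (y ∷ ys)
pairs-++ [] y ys = refl
pairs-++ (x ∷ []) y ys = refl
pairs-++ (x ∷ x′ ∷ xs) y ys = cong ((x , x′) ∷_) (pairs-++ (x′ ∷ xs) y ys)

pairs-map-proj₁ : ∀ x (xs : List A) y → map proj₁ (pairs (x ∷ xs ∷ʳ y)) ≡ x ∷ xs
pairs-map-proj₁ x [] y = refl
pairs-map-proj₁ x (x′ ∷ xs) y = cong (x ∷_) (pairs-map-proj₁ x′ xs y)

pairs-map-proj₂ : ∀ x (xs : List A) → map proj₂ (pairs (x ∷ xs)) ≡ xs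
pairs-map-proj₂ x [] = refl
pairs-map-proj₂ x (x′ ∷ xs) = cong (x′ ∷_) (pairs-map-proj₂ x′ xs)

pairs-∈ˡ : ∀ (xs : List A) {a b} → (a , b) ∈ₗ pairs xs → a ∈ₗ xs
pairs-∈ˡ (x ∷ y ∷ xs) (here refl) = here refl
pairs-∈ˡ (x ∷ y ∷ xs) (there p) = there (pairs-∈ˡ (y ∷ xs) p)

pairs-∈ʳ : ∀ (xs : List A) {a b} → (a , b) ∈ₗ pairs xs → b ∈ₗ xs
pairs-∈ʳ (x ∷ y ∷ xs) (here refl) = there (here refl)
pairs-∈ʳ (x ∷ y ∷ xs) (there p) = there (pairs-∈ʳ (y ∷ xs) p)

pairs-split : ∀ (xs : List A) {a b} → (a , b) ∈ₗ pairs xs → ∃₂ λ as bs → xs ≡ as ++ a ∷ b ∷ bs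
pairs-split (x ∷ y ∷ xs) (here refl) = [] , xs , refl
pairs-split (x ∷ y ∷ xs) (there p) with pairs-split (y ∷ xs) p
... | as , bs , e = x ∷ as , bs , cong (x ∷_) e

pairs-reverse : ∀ (xs : List A) {d} → d ∈ₗ pairs xs → swap d ∈ₗ pairs (reverse xs)
pairs-reverse (x ∷ y ∷ xs) {d} d∈ = subst (swap d ∈ₗ_) (sym eq) (go d∈)
  where
  eq : pairs (reverse (x ∷ y ∷ xs)) ≡ pairs (reverse (y ∷ xs)) ++ (y , x) ∷ []
  eq = begin
    pairs (reverse (x ∷ y ∷ xs))                 ≡⟨ cong pairs (unfold-reverse x (y ∷ xs)) ⟩
    pairs (reverse (y ∷ xs) ∷ʳ x)                ≡⟨ cong (λ l → pairs (l ∷ʳ x)) (unfold-reverse y xs) ⟩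
    pairs (reverse xs ∷ʳ y ∷ʳ x)                 ≡⟨ cong pairs (∷ʳ-++ (reverse xs) y _) ⟩
    pairs (reverse xs ++ y ∷ x ∷ [])             ≡⟨ pairs-++ (reverse xs) y _ ⟩
    pairs (reverse xs ∷ʳ y) ++ (y , x) ∷ []      ≡⟨ cong (λ l → pairs l ++ _) (unfold-reverse y xs) ⟨
    pairs (reverse (y ∷ xs)) ++ (y , x) ∷ []     ∎
    where open ≡-Reasoning
  go : d ∈ₗ pairs (x ∷ y ∷ xs) → swap d ∈ₗ pairs (reverse (y ∷ xs)) ++ (y , x) ∷ []
  go (here refl) = ∈-++⁺ʳ (pairs (reverse (y ∷ xs))) (here refl)
  go (there p) = ∈-++⁺ˡ (pairs-reverse (y ∷ xs) p)

linked⇒pairs : {R : Rel A 0ℓ} {xs : List A} → Linked R xs → ∀ {a b} → (a , b) ∈ₗ pairs xs → R a b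
linked⇒pairs (r ∷ rs) (here refl) = r
linked⇒pairs (r ∷ rs) (there p) = linked⇒pairs rs p

pairs⇒linked : {R : Rel A 0ℓ} (xs : List A) → (∀ {a b} → (a , b) ∈ₗ pairs xs → R a b) → Linked R xs
pairs⇒linked [] f = []
pairs⇒linked (x ∷ []) f = [-]
pairs⇒linked (x ∷ y ∷ xs) f = f (here refl) ∷ pairs⇒linked (y ∷ xs) (f ∘ there)

-- Components of a multigraph given by its list of edges

LinkOf : List (A × A) → Rel A 0ℓ
LinkOf es x y = (x , y) ∈ₗ es ⊎ (y , x) ∈ₗ es

module _ {a b : A} {es : List (A × A)} where

  -- A path that uses the edge is cut at its first and last use: the piece before the first ends at
  -- `a` or `b`, and the piece after the last starts at one of them.
  cut-edge : ∀ {x r} → Star (LinkOf ((a , b) ∷ es)) x r →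
             Star (LinkOf es) x r ⊎
             ((Star (LinkOf es) x a ⊎ Star (LinkOf es) x b) × (Star (LinkOf es) a r ⊎ Star (LinkOf es) b r))
  cut-edge ε = inj₁ ε
  cut-edge (inj₁ (here refl) ◅ p) = inj₂ (inj₁ ε , [ inj₂ , proj₂ ]′ (cut-edge p))
  cut-edge (inj₂ (here refl) ◅ p) = inj₂ (inj₂ ε , [ inj₁ , proj₂ ]′ (cut-edge p))
  cut-edge (inj₁ (there s) ◅ p) = ⊎-map (inj₁ s ◅_) (λ (q , r) → ⊎-map (inj₁ s ◅_) (inj₁ s ◅_) q , r) (cut-edge p)
  cut-edge (inj₂ (there s) ◅ p) = ⊎-map (inj₂ s ◅_) (λ (q , r) → ⊎-map (inj₂ s ◅_) (inj₂ s ◅_) q , r) (cut-edge p)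

-- Deleting an edge separates at most one new component, for which one of its ends serves as a new root.
order≤edges+roots : ∀ {n} (es : List (Fin n × Fin n)) (rs : List (Fin n)) →
                    (∀ x → ∃ λ r → r ∈ₗ rs × Star (LinkOf es) x r) → n ≤ length es + length rs
order≤edges+roots {n} [] rs root =
  subst (_≤ length rs) (length-tabulate {n = n} id) (unique-⊆⇒length≤ (Unique.allFin⁺ n) (λ {x} _ → go x (root x)))
  where
  go : ∀ x → (∃ λ r → r ∈ₗ rs × Star (LinkOf []) x r) → x ∈ₗ rs
  go x (r , r∈ , ε) = r∈
  go x (r , r∈ , inj₁ () ◅ _)
  go x (r , r∈ , inj₂ () ◅ _)
order≤edges+roots {n} ((a , b) ∷ es) rs root with root a
... | r₀ , r₀∈ , p₀ = [ (λ a⇝r → add b λ { (inj₁ q) → inj₁ (q ◅◅ a⇝r) ; (inj₂ q) → inj₂ q })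
                     , (λ b⇝r → add a λ { (inj₁ q) → inj₂ q ; (inj₂ q) → inj₁ (q ◅◅ b⇝r) }) ]′
                     ([ inj₁ , proj₂ ]′ (cut-edge p₀))
  where
  S = Star (LinkOf es)
  add : ∀ c → (∀ {x} → S x a ⊎ S x b → S x r₀ ⊎ S x c) → n ≤ suc (length es + length rs)
  add c f = subst (n ≤_) (ℕ.+-suc (length es) (length rs)) (order≤edges+roots es (c ∷ rs) root′)
    where
    root′ : ∀ x → ∃ λ r → r ∈ₗ (c ∷ rs) × S x r
    root′ x with root x
    ... | r , r∈ , p with cut-edge p
    ... | inj₁ q = r , there r∈ , q
    ... | inj₂ (q , _) with f q
    ... | inj₁ q′ = r₀ , there r₀∈ , q′
    ... | inj₂ q′ = c , here refl , q′

-- Rotation at a cubic vertex and face tracing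

fold-closed : (P : Pred A 0ℓ) (f : A → A) → (∀ {x} → P x → P (f x)) → ∀ {x} k → P x → P (fold x f k)
fold-closed P f h zero px = px
fold-closed P f h (suc k) px = h (fold-closed P f h k px)

module CubicPlane {G : SimpleGraph} (cubic : SimpleGraph.Cubic G) (Γ : PlaneEmbedding G) where
  open SimpleGraph G public
  open PlaneEmbedding Γ public

  neighbours : Vertex → List Vertex
  neighbours v = filter (Adj? v) (allFin order)

  neighbours-unique : ∀ v → Unique (neighbours v)
  neighbours-unique v = Unique.filter⁺ (Adj? v) (Unique.allFin⁺ order)

  at-most-3 : ∀ v {xs} → Unique xs → All (Adj v) xs → length xs ≤ 3
  at-most-3 v {xs} u adj = subst (length xs ≤_) (cubic v)
    (unique-⊆⇒length≤ u (λ x∈ → ∈-filter⁺ (Adj? v) (∈-allFin _) (All.lookup adj x∈)))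

  at-least-3 : ∀ v xs → (∀ {w} → Adj v w → w ∈ₗ xs) → 3 ≤ length xs
  at-least-3 v xs cover = subst (_≤ length xs) (cubic v)
    (unique-⊆⇒length≤ (neighbours-unique v) (λ w∈ → cover (proj₂ (∈-filter⁻ (Adj? v) {xs = allFin order} w∈))))

  -- By `rot-cyclic` a list closed under `rot v` that contains one neighbour contains all three.
  -- Lists of length one and two then exclude fixed points and 2-cycles of the rotation.
  rot-orbit-long : ∀ {v a} → Adj v a → ∀ xs → a ∈ₗ xs → (∀ {x} → x ∈ₗ xs → rot v x ∈ₗ xs) → 3 ≤ length xs
  rot-orbit-long {v} {a} va xs a∈ closed = at-least-3 v xs λ vw →
    let k , e = rot-cyclic va vw in subst (_∈ₗ xs) e (fold-closed (_∈ₗ xs) (rot v) closed k a∈)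

  rot≢ : ∀ {v a} → Adj v a → rot v a ≢ a
  rot≢ {v} {a} va e = case rot-orbit-long va (a ∷ []) (here refl) (λ { (here refl) → here e }) of λ { (s≤s ()) }

  rot²≢ : ∀ {v a} → Adj v a → rot v (rot v a) ≢ a
  rot²≢ {v} {a} va e = case rot-orbit-long va (a ∷ rot v a ∷ []) (here refl)
    (λ { (here refl) → there (here refl) ; (there (here refl)) → here e }) of λ { (s≤s (s≤s ())) }

  -- Otherwise `a` and its first three images would be four distinct neighbours.
  rot³ : ∀ {v a} → Adj v a → rot v (rot v (rot v a)) ≡ a
  rot³ {v} {a} va with rot v (rot v (rot v a)) ≟ a
  ... | yes e = e
  ... | no ≢a = ⊥-elim (ℕ.<⇒≱ ℕ.≤-refl (at-most-3 v
          (((λ e → rot≢ va (sym e)) ∷ (λ e → rot²≢ va (sym e)) ∷ (λ e → ≢a (sym e)) ∷ [])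
           ∷ ((λ e → rot≢ vb (sym e)) ∷ (λ e → rot²≢ vb (sym e)) ∷ [])
           ∷ ((λ e → rot≢ vc (sym e)) ∷ [])
           ∷ [] ∷ [])
          (va ∷ vb ∷ vc ∷ vd ∷ [])))
    where
    vb = rot-adj va
    vc = rot-adj vb
    vd = rot-adj vc

  around : ∀ {v a w} → Adj v a → Adj v w → w ∈ₗ (a ∷ rot v a ∷ rot v (rot v a) ∷ [])
  around {v} {a} va vw = let k , e = rot-cyclic va vw in
    subst (_∈ₗ _) e (fold-closed (_∈ₗ (a ∷ rot v a ∷ rot v (rot v a) ∷ [])) (rot v)
      (λ { (here refl) → there (here refl)
         ; (there (here refl)) → there (there (here refl))
         ; (there (there (here refl))) → here (rot³ va) }) k (here refl))

  -- In a cyclic order of three neighbours any two are consecutive in one direction. Hence any two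
  -- corners at `v` are separated by a single edge at `v`.
  adjacent-corners : ∀ {v a b} → Adj v a → Adj v b → a ≢ b → b ≡ rot v a ⊎ a ≡ rot v b
  adjacent-corners va vb a≢b with around va vb
  ... | here e = ⊥-elim (a≢b (sym e))
  ... | there (here e) = inj₁ e
  ... | there (there (here refl)) = inj₂ (sym (rot³ va))

  neighbour : ∀ v → ∃ λ w → Adj v w
  neighbour v with neighbours v in eq
  ... | [] = case trans (sym (cubic v)) (cong length eq) of λ ()
  ... | w ∷ _ = w , proj₂ (∈-filter⁻ (Adj? v) {xs = allFin order} (subst (w ∈ₗ_) (sym eq) (here refl)))

  IsDart : Pred Dart 0ℓ
  IsDart (u , v) = Adj u v

  next : Dart → Dart
  next (u , v) = v , rot v u

  -- The inverse of the face-tracing map `next`: a rotation of order three has its square as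
  -- inverse.
  prev : Dart → Dart
  prev (v , w) = rot v (rot v w) , v

  next-isDart : ∀ {d} → IsDart d → IsDart (next d)
  next-isDart uv = rot-adj (Adj-sym uv)

  prev-isDart : ∀ {d} → IsDart d → IsDart (prev d)
  prev-isDart vw = Adj-sym (rot-adj (rot-adj vw))

  next-prev : ∀ {d} → IsDart d → next (prev d) ≡ d
  next-prev {v , w} vw = cong (v ,_) (rot³ vw)

  prev-next : ∀ {d} → IsDart d → prev (next d) ≡ d
  prev-next {u , v} uv = cong (_, v) (rot³ (Adj-sym uv))

  same-edge? : Decidable₂ SameEdge
  same-edge? d e = ≡-dec _≟_ _≟_ d e ⊎-dec ≡-dec _≟_ _≟_ d (swap e)

  same-sym : Symmetric SameEdge
  same-sym (inj₁ e) = inj₁ (sym e)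
  same-sym (inj₂ e) = inj₂ (sym (cong swap e))

  same-swapˡ : ∀ {d e} → SameEdge d e → SameEdge (swap d) e
  same-swapˡ (inj₁ refl) = inj₂ refl
  same-swapˡ (inj₂ refl) = inj₁ refl

  same-trans : ∀ {d e f} → SameEdge d e → SameEdge e f → SameEdge d f
  same-trans (inj₁ refl) q = q
  same-trans (inj₂ refl) q = same-swapˡ q

-- Replacing an edge of a cycle by a path

unique-∷ʳ : ∀ (xs : List A) {y} → Unique (xs ∷ʳ y) → Unique (y ∷ xs)
unique-∷ʳ xs {y} = unique-resp-↭ (++-comm xs (y ∷ []))

module CycleSurgery (G : SimpleGraph) where
  open SimpleGraph G

  any-same⁻ : ∀ {d es} → Any (SameEdge d) es → d ∈ₗ es ⊎ swap d ∈ₗ es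
  any-same⁻ (here (inj₁ e)) = inj₁ (here e)
  any-same⁻ (here (inj₂ e)) = inj₂ (here (cong swap e))
  any-same⁻ (there p) = ⊎-map there there (any-same⁻ p)

  any-same⁺ : ∀ {d es} → d ∈ₗ es ⊎ swap d ∈ₗ es → Any (SameEdge d) es
  any-same⁺ (inj₁ p) = Any.map inj₁ p
  any-same⁺ (inj₂ p) = Any.map (inj₂ ∘ cong swap) p

  -- Used in `reroute`: deleting the edge `uv` takes nothing from the two paths that make up the new
  -- cycle.
  ends-not-consecutive : ∀ {a ms b} → ms ≢ [] → Unique (a ∷ ms ∷ʳ b) → ∀ {d} → SameEdge d (a , b) →
                         ¬ Any (SameEdge d) (pairs (a ∷ ms ∷ʳ b))
  ends-not-consecutive {ms = []} ms≢ u s p = ms≢ refl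
  ends-not-consecutive {a} {m ∷ ms} {b} _ u s p = [ ab∉ , ba∉ ]′ (either s (any-same⁻ p))
    where
    either : ∀ {d es} → SameEdge d (a , b) → d ∈ₗ es ⊎ swap d ∈ₗ es → (a , b) ∈ₗ es ⊎ (b , a) ∈ₗ es
    either (inj₁ refl) q = q
    either (inj₂ refl) q = ⊎-swap q
    a∉ : a ∉ₗ m ∷ ms ∷ʳ b
    a∉ = unique-∉ u
    ab∉ : ¬ (a , b) ∈ₗ pairs (a ∷ m ∷ ms ∷ʳ b)
    ab∉ (here refl) = unique-∉ (AllPairs.tail u) (∈-++⁺ʳ ms (here refl))
    ab∉ (there q) = a∉ (pairs-∈ˡ (m ∷ ms ∷ʳ b) q)
    ba∉ : ¬ (b , a) ∈ₗ pairs (a ∷ m ∷ ms ∷ʳ b)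
    ba∉ (here refl) = a∉ (here refl)
    ba∉ (there q) = a∉ (pairs-∈ʳ (m ∷ ms ∷ʳ b) q)

  -- A cycle through the edge uv, cut open at that edge into a path from v to u.
  record OpenedCycle (σ : Subgraph) (u v : Vertex) : Set where
    field
      middle        : List Vertex
      middle≢[]     : middle ≢ []
      path-unique   : Unique (v ∷ middle ∷ʳ u)
      path-adjacent : ∀ {a b} → (a , b) ∈ₗ pairs (v ∷ middle ∷ʳ u) → Adj a b
      vertex⇒path   : ∀ {x} → x ∈ vertices σ → x ∈ₗ v ∷ middle ∷ʳ u
      path⇒vertex   : ∀ {x} → x ∈ₗ v ∷ middle ∷ʳ u → x ∈ vertices σ
      edge⇒path     : ∀ {d} → d ∈ edges σ → SameEdge d (u , v) ⊎ Any (SameEdge d) (pairs (v ∷ middle ∷ʳ u))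
      path⇒edge     : ∀ {d} → Any (SameEdge d) (pairs (v ∷ middle ∷ʳ u)) → d ∈ edges σ

  reverse-∷-∷ʳ : ∀ a (ms : List A) b → reverse (a ∷ ms ∷ʳ b) ≡ b ∷ reverse ms ∷ʳ a
  reverse-∷-∷ʳ a ms b = trans (unfold-reverse a (ms ∷ʳ b)) (cong (_∷ʳ a) (reverse-++ ms (b ∷ [])))

  -- The edge set of a subgraph contains both darts of an edge, but the vertex list of a cycle
  -- passes it in one direction; reversal treats the other direction.
  flip-opened : ∀ {σ u v} → OpenedCycle σ u v → OpenedCycle σ v u
  flip-opened {σ} {u} {v} O = record
    { middle = reverse middle
    ; middle≢[] = λ e → middle≢[] (trans (sym (reverse-involutive middle)) (cong reverse e))
    ; path-unique = subst Unique eq (unique-resp-↭ (↭-sym (↭-reverse path)) path-unique)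
    ; path-adjacent = λ p → Adj-sym (path-adjacent (back p))
    ; vertex⇒path = λ x∈ → ∈-resp-≡ eq (Any.reverse⁺ (vertex⇒path x∈))
    ; path⇒vertex = λ x∈ → path⇒vertex (Any.reverse⁻ (∈-resp-≡ (sym eq) x∈))
    ; edge⇒path = λ d∈ → ⊎-map ⊎-swap (λ p → any-same⁺ (⊎-swap (⊎-map forth forth (any-same⁻ p)))) (edge⇒path d∈)
    ; path⇒edge = λ p → path⇒edge (any-same⁺ (⊎-swap (⊎-map back back (any-same⁻ p))))
    }
    where
    open OpenedCycle O
    path = v ∷ middle ∷ʳ u
    eq : reverse path ≡ u ∷ reverse middle ∷ʳ v
    eq = reverse-∷-∷ʳ v middle u
    forth : ∀ {d} → d ∈ₗ pairs path → swap d ∈ₗ pairs (u ∷ reverse middle ∷ʳ v)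
    forth {d} p = ∈-resp-≡ (cong pairs eq) (pairs-reverse path p)
    back : ∀ {d} → d ∈ₗ pairs (u ∷ reverse middle ∷ʳ v) → swap d ∈ₗ pairs path
    back {d} p = ∈-resp-≡ (cong pairs (trans (cong reverse (sym eq)) (reverse-involutive path)))
                   (pairs-reverse (u ∷ reverse middle ∷ʳ v) p)

  -- The closed list is rotated: the path runs from `b` to the end of the list and continues from
  -- its beginning to `a`. The vertex `base`, which the closed list has at both ends, is kept once,
  -- so `ys` is `b ∷ bs` without its last entry.
  open-directed : ∀ (C : Cycle) {u v} → let open Cycle C in
                  (u , v) ∈ₗ pairs (base ∷ others ∷ʳ base) → OpenedCycle (cycleGraph C) u v
  open-directed C {a} {b} ab∈ with pairs-split _ ab∈
  ... | as , bs , closed≡ = record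
    { middle = proj₁ shape
    ; middle≢[] = middle≢[]
    ; path-unique = subst Unique (proj₂ shape) (unique-resp-↭ (++-comm (as ∷ʳ a) ys) (subst Unique open≡ distinct))
    ; path-adjacent = λ p → linked⇒pairs linked (pairs⇐ p)
    ; vertex⇒path = vertex⇒path
    ; path⇒vertex = λ x∈ → ∈-++⁺ˡ (∈-resp-≡ (sym open≡)
                            (∈-resp-↭ (++-comm ys (as ∷ʳ a)) (∈-resp-≡ (sym (proj₂ shape)) x∈)))
    ; edge⇒path = λ p → [ ⊎-map inj₁ (any-same⁺ ∘ inj₁) ∘ pairs⇒
                        , ⊎-map (inj₂ ∘ cong swap) (any-same⁺ ∘ inj₂) ∘ pairs⇒ ]′ (any-same⁻ p)
    ; path⇒edge = λ p → any-same⁺ (⊎-map pairs⇐ pairs⇐ (any-same⁻ p))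
    }
    where
    open Cycle C
    snoc : ∀ (x : Vertex) xs → ∃₂ λ ys z → x ∷ xs ≡ ys ∷ʳ z
    snoc x [] = [] , x , refl
    snoc x (y ∷ xs) = let ys , z , e = snoc y xs in x ∷ ys , z , cong (x ∷_) e
    ys = proj₁ (snoc b bs)
    z = proj₁ (proj₂ (snoc b bs))
    split : base ∷ others ∷ʳ base ≡ (as ∷ʳ a ++ ys) ∷ʳ z
    split = begin
      base ∷ others ∷ʳ base    ≡⟨ closed≡ ⟩
      as ++ a ∷ b ∷ bs         ≡⟨ ∷ʳ-++ as a (b ∷ bs) ⟨
      as ∷ʳ a ++ b ∷ bs        ≡⟨ cong (as ∷ʳ a ++_) (proj₂ (proj₂ (snoc b bs))) ⟩
      as ∷ʳ a ++ (ys ∷ʳ z)     ≡⟨ ++-assoc (as ∷ʳ a) ys _ ⟨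
      (as ∷ʳ a ++ ys) ∷ʳ z     ∎
      where open ≡-Reasoning
    open≡ : base ∷ others ≡ as ∷ʳ a ++ ys
    open≡ = proj₁ (∷ʳ-injective (base ∷ others) _ split)
    tail≡ : b ∷ bs ≡ ys ∷ʳ base
    tail≡ = trans (proj₂ (proj₂ (snoc b bs))) (cong (ys ∷ʳ_) (sym (proj₂ (∷ʳ-injective (base ∷ others) _ split))))
    -- The arc up to `a` starts at `base`, where the other arc ends; `path-pairs` glues the two arcs
    -- there.
    front-of : ∀ as {xs} → base ∷ others ≡ as ∷ʳ a ++ xs → ∃ λ zs → as ∷ʳ a ≡ base ∷ zs
    front-of [] refl = [] , refl
    front-of (x ∷ as) refl = as ∷ʳ a , refl
    front = front-of as open≡
    shape-of : ∀ ys as → b ∷ bs ≡ ys ∷ʳ base → base ∷ others ≡ as ∷ʳ a ++ ys → ∃ λ ms → ys ++ as ∷ʳ a ≡ b ∷ ms ∷ʳ a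
    -- With both arcs trivial the cycle would have a single vertex.
    shape-of [] [] e e′ = case subst (2 ≤_) (cong length (proj₂ (∷-injective e′))) long of λ ()
    shape-of [] (x ∷ as) refl refl = as , refl
    shape-of (y ∷ ys) as refl _ = ys ++ as , cong (b ∷_) (sym (++-assoc ys as _))
    shape = shape-of ys as tail≡ open≡
    middle≢[] : proj₁ shape ≢ []
    middle≢[] e = ℕ.<⇒≱ (s≤s long) (ℕ.≤-reflexive (begin
      length (base ∷ others)           ≡⟨ cong length open≡ ⟩
      length (as ∷ʳ a ++ ys)           ≡⟨ length-++ (as ∷ʳ a) ⟩
      length (as ∷ʳ a) + length ys     ≡⟨ ℕ.+-comm (length (as ∷ʳ a)) _ ⟩
      length ys + length (as ∷ʳ a)     ≡⟨ length-++ ys ⟨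
      length (ys ++ as ∷ʳ a)           ≡⟨ cong length (proj₂ shape) ⟩
      length (b ∷ proj₁ shape ∷ʳ a)    ≡⟨ cong (λ ms → length (b ∷ ms ∷ʳ a)) e ⟩
      2                                ∎))
      where open ≡-Reasoning
    closed-pairs : pairs (base ∷ others ∷ʳ base) ≡ pairs (as ∷ʳ a) ++ (a , b) ∷ pairs (ys ∷ʳ base)
    closed-pairs = begin
      pairs (base ∷ others ∷ʳ base)                   ≡⟨ cong pairs closed≡ ⟩
      pairs (as ++ a ∷ b ∷ bs)                        ≡⟨ pairs-++ as a (b ∷ bs) ⟩
      pairs (as ∷ʳ a) ++ (a , b) ∷ pairs (b ∷ bs)     ≡⟨ cong (λ l → pairs (as ∷ʳ a) ++ (a , b) ∷ pairs l) tail≡ ⟩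
      pairs (as ∷ʳ a) ++ (a , b) ∷ pairs (ys ∷ʳ base) ∎
      where open ≡-Reasoning
    path-pairs : pairs (b ∷ proj₁ shape ∷ʳ a) ≡ pairs (ys ∷ʳ base) ++ pairs (as ∷ʳ a)
    path-pairs = begin
      pairs (b ∷ proj₁ shape ∷ʳ a)                         ≡⟨ cong pairs (proj₂ shape) ⟨
      pairs (ys ++ as ∷ʳ a)                                ≡⟨ cong (λ l → pairs (ys ++ l)) (proj₂ front) ⟩
      pairs (ys ++ base ∷ proj₁ front)                     ≡⟨ pairs-++ ys base _ ⟩
      pairs (ys ∷ʳ base) ++ pairs (base ∷ proj₁ front)     ≡⟨ cong (λ l → pairs (ys ∷ʳ base) ++ pairs l) (proj₂ front) ⟨
      pairs (ys ∷ʳ base) ++ pairs (as ∷ʳ a)                ∎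
      where open ≡-Reasoning
    pairs⇒ : ∀ {d} → d ∈ₗ pairs (base ∷ others ∷ʳ base) → d ≡ (a , b) ⊎ d ∈ₗ pairs (b ∷ proj₁ shape ∷ʳ a)
    pairs⇒ {d} d∈ with ∈-++⁻ (pairs (as ∷ʳ a)) (∈-resp-≡ closed-pairs d∈)
    ... | inj₁ p = inj₂ (∈-resp-≡ (sym path-pairs) (∈-++⁺ʳ (pairs (ys ∷ʳ base)) p))
    ... | inj₂ (here e) = inj₁ e
    ... | inj₂ (there p) = inj₂ (∈-resp-≡ (sym path-pairs) (∈-++⁺ˡ p))
    pairs⇐ : ∀ {d} → d ∈ₗ pairs (b ∷ proj₁ shape ∷ʳ a) → d ∈ₗ pairs (base ∷ others ∷ʳ base)
    pairs⇐ {d} d∈ with ∈-++⁻ (pairs (ys ∷ʳ base)) (∈-resp-≡ path-pairs d∈)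
    ... | inj₁ p = ∈-resp-≡ (sym closed-pairs) (∈-++⁺ʳ (pairs (as ∷ʳ a)) (there p))
    ... | inj₂ p = ∈-resp-≡ (sym closed-pairs) (∈-++⁺ˡ p)
    open⇒path : ∀ {x} → x ∈ₗ base ∷ others → x ∈ₗ b ∷ proj₁ shape ∷ʳ a
    open⇒path x∈ = ∈-resp-≡ (proj₂ shape) (∈-resp-↭ (++-comm (as ∷ʳ a) ys) (∈-resp-≡ open≡ x∈))
    vertex⇒path : ∀ {x} → x ∈ₗ base ∷ others ∷ʳ base → x ∈ₗ b ∷ proj₁ shape ∷ʳ a
    vertex⇒path x∈ with ∈-++⁻ (base ∷ others) x∈
    ... | inj₁ p = open⇒path p
    ... | inj₂ (here refl) = open⇒path (here refl)

  IsCycle : Subgraph → Set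
  IsCycle σ = Σ Cycle λ C → σ ≋ cycleGraph C

  open-cycle : ∀ {σ u v} → IsCycle σ → (u , v) ∈ edges σ → OpenedCycle σ u v
  open-cycle {σ} {u} {v} (C , (v⇒ , v⇐) , (e⇒ , e⇐)) uv∈ =
    record
    { OpenedCycle O
    ; vertex⇒path = OpenedCycle.vertex⇒path O ∘ v⇒
    ; path⇒vertex = v⇐ ∘ OpenedCycle.path⇒vertex O
    ; edge⇒path = OpenedCycle.edge⇒path O ∘ e⇒
    ; path⇒edge = e⇐ ∘ OpenedCycle.path⇒edge O
    }
    where
    O : OpenedCycle (cycleGraph C) u v
    O = [ open-directed C , flip-opened ∘ open-directed C ]′ (any-same⁻ (e⇒ uv∈))

  -- The new closed list follows the path from `u` to `v` and returns along the rest of the old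
  -- cycle. With an empty interior the path would be the deleted edge itself.
  reroute : ∀ {σ u v interior} → OpenedCycle σ u v → interior ≢ [] →
            Linked Adj (u ∷ interior ∷ʳ v) → Unique (u ∷ interior ∷ʳ v) → All (_∉ vertices σ) interior →
            IsCycle (σ ⊞ walkGraph (u ∷ interior ∷ʳ v) ⊟ (u , v))
  reroute {σ} {u} {v} {interior} opened int≢ lnk unq disj = C′ , (v⇒ , v⇐) , (e⇒ , e⇐)
    where
    open OpenedCycle opened
    P Q closed : List Vertex
    P = u ∷ interior ∷ʳ v
    Q = v ∷ middle ∷ʳ u
    closed = u ∷ (interior ++ v ∷ middle) ∷ʳ u
    closed≡ : closed ≡ (u ∷ interior) ++ Q
    closed≡ = cong (u ∷_) (++-assoc interior (v ∷ middle) _)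
    closed-pairs : pairs closed ≡ pairs P ++ pairs Q
    closed-pairs = trans (cong pairs closed≡) (pairs-++ (u ∷ interior) v (middle ∷ʳ u))
    long : 2 ≤ length (interior ++ v ∷ middle)
    long = long-of interior int≢
      where
      long-of : ∀ xs → xs ≢ [] → 2 ≤ length (xs ++ v ∷ middle)
      long-of [] ne = ⊥-elim (ne refl)
      long-of (x ∷ xs) _ = s≤s (subst (1 ≤_) (sym (length-++ xs)) (ℕ.≤-trans (s≤s z≤n) (ℕ.m≤n+m _ (length xs))))
    disjoint : ∀ {x} → x ∈ₗ u ∷ interior × x ∈ₗ v ∷ middle → ⊥
    disjoint (here refl , q) = unique-∉ (unique-∷ʳ (v ∷ middle) path-unique) q
    disjoint (there p , q) = All.lookup disj p (path⇒vertex (∈-++⁺ˡ q))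
    C′ : Cycle
    C′ = record
      { base = u
      ; others = interior ++ v ∷ middle
      ; long = long
      ; distinct = Unique.++⁺ (AllPairs.tail (unique-∷ʳ (u ∷ interior) unq))
                                (AllPairs.tail (unique-∷ʳ (v ∷ middle) path-unique)) disjoint
      ; linked = pairs⇒linked closed λ p →
          [ linked⇒pairs lnk , path-adjacent ]′ (∈-++⁻ (pairs P) (∈-resp-≡ closed-pairs p))
      }
    v⇒ : ∀ {x} → x ∈ vertices σ ⊎ x ∈ₗ P → x ∈ₗ closed
    v⇒ (inj₁ p) = ∈-resp-≡ (sym closed≡) (∈-++⁺ʳ (u ∷ interior) (vertex⇒path p))
    v⇒ (inj₂ p) with ∈-++⁻ (u ∷ interior) p
    ... | inj₁ q = ∈-resp-≡ (sym closed≡) (∈-++⁺ˡ q)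
    ... | inj₂ (here refl) = ∈-resp-≡ (sym closed≡) (∈-++⁺ʳ (u ∷ interior) (here refl))
    v⇐ : ∀ {x} → x ∈ₗ closed → x ∈ vertices σ ⊎ x ∈ₗ P
    v⇐ p with ∈-++⁻ (u ∷ interior) (∈-resp-≡ closed≡ p)
    ... | inj₁ q = inj₂ (∈-++⁺ˡ q)
    ... | inj₂ q = inj₁ (path⇒vertex q)
    e⇒ : ∀ {d} → (d ∈ edges σ ⊎ Any (SameEdge d) (pairs P)) × ¬ SameEdge d (u , v) → Any (SameEdge d) (pairs closed)
    e⇒ (inj₁ p , ≢e) = [ (λ s → ⊥-elim (≢e s)) , (λ q → subst (Any _) (sym closed-pairs) (Any.++⁺ʳ (pairs P) q)) ]′ (edge⇒path p)
    e⇒ (inj₂ p , ≢e) = subst (Any _) (sym closed-pairs) (Any.++⁺ˡ p)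
    e⇐ : ∀ {d} → Any (SameEdge d) (pairs closed) → (d ∈ edges σ ⊎ Any (SameEdge d) (pairs P)) × ¬ SameEdge d (u , v)
    e⇐ p with Any.++⁻ (pairs P) (subst (Any _) closed-pairs p)
    ... | inj₁ q = inj₂ q , λ s → ends-not-consecutive int≢ unq s q
    ... | inj₂ q = inj₁ (path⇒edge q) , λ s → ends-not-consecutive middle≢[] path-unique (⊎-swap s) q

-- From a run to a Hamiltonian cycle

module RunCycle {G : SimpleGraph} (cubic : SimpleGraph.Cubic G) (Γ : PlaneEmbedding G) where
  open CubicPlane cubic Γ
  open CycleSurgery G

  -- With an empty interior the face has `e` as its only edge, so face tracing would lead from a
  -- dart of `e` to `e` again; but the graph has no loops and the rotation has no fixed points.
  interior≢[] : ∀ {σ e} (P : ComplementaryPath Γ σ e) → ComplementaryPath.interior P ≢ []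
  interior≢[] {σ} {u , v} P eq = [ next-differs (inj₁ refl) uv , next-differs (inj₂ refl) (Adj-sym uv) ]′ side
    where
    open ComplementaryPath P
    only-e : ∀ {d} → d ∈ edges (boundary face) → SameEdge d (u , v)
    only-e {d} d∈ with subst (λ l → d ∈ edges (walkGraph (u ∷ l ∷ʳ v) ⊞ edgeGraph (u , v))) eq (proj₁ (proj₂ bounds) d∈)
    ... | inj₁ (here s) = s
    ... | inj₂ (here s) = s
    e∈ : (u , v) ∈ edges (boundary face)
    e∈ = proj₂ (proj₂ bounds) (inj₂ (here (inj₁ refl)))
    uv = proj₁ e∈
    side = proj₂ e∈
    next-differs : ∀ {d} → SameEdge d (u , v) → IsDart d → left d ≢ face
    next-differs {x , y} s xy left≡ 
      with same-trans (only-e (next-isDart xy , inj₁ (trans (sym (left-trace xy)) left≡))) (same-sym s)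
    ... | inj₁ q = Adj-irrefl (sym (cong proj₁ q)) xy
    ... | inj₂ q = rot≢ (Adj-sym xy) (cong proj₂ q)

  -- Such a vertex shows that the face is new, and in the converse that no complementary path
  -- remains once σ contains all vertices.
  some-interior : ∀ {σ e} (P : ComplementaryPath Γ σ e) →
                  ∃ λ x → x ∈ vertices (boundary (ComplementaryPath.face P)) × x ∉ vertices σ
  some-interior {e = u , v} P with ComplementaryPath.interior P in eq | interior≢[] P
  ... | [] | ne = ⊥-elim (ne refl)
  ... | x ∷ xs | _ = x , proj₂ (proj₁ bounds) (inj₁ (there (∈-++⁺ˡ x∈))) , All.lookup internally-disjoint x∈
    where
    open ComplementaryPath P
    x∈ : x ∈ₗ interior
    x∈ = ∈-resp-≡ (sym eq) (here refl)

  Visits : ∀ {σ} → Pred Face 0ℓ → RunFrom Γ σ → Pred Face 0ℓ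
  Visits V r φ = φ ∈ V ⊎ Any (λ e → φ ≡ left e ⊎ φ ≡ right Γ e) (chosen Γ r)

  -- Induction on the run, with `V` the faces visited so far. As each edge of σ borders a face in
  -- `V`, and the face of the complementary path is not in `V`, the chosen edge has a visited face
  -- on one side and the new face on the other; so both ends of its dual edge lie in `V′`.
  run-cycle : ∀ {σ} (V : Pred Face 0ℓ) → IsCycle σ →
              (∀ {φ} → φ ∈ V → ∀ {v} → v ∈ vertices (boundary φ) → v ∈ vertices σ) →
              (∀ {d} → d ∈ edges σ → left d ∈ V ⊎ right Γ d ∈ V) →
              (r : RunFrom Γ σ) →
              Σ Cycle λ C → ∀ {φ} → φ ∈ Visits V r → ∀ {v} → v ∈ vertices (boundary φ) → v ∈ vertices (cycleGraph C)
  run-cycle V (C , σ≋) covered sided (stop _) =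
    C , λ { (inj₁ φ∈) v∈ → proj₁ (proj₁ σ≋) (covered φ∈ v∈) }
  run-cycle {σ} V cyc covered sided (step e@(u , v) e∈ P r) =
    let C , visits = run-cycle V′ (reroute (open-cycle cyc e∈) (interior≢[] P) path-linked path-distinct internally-disjoint)
                               covered′ sided′ r
    in C , λ { (inj₁ φ∈) → visits (inj₁ (inj₁ φ∈))
             ; (inj₂ (here (inj₁ refl))) → visits (inj₁ (proj₁ ends))
             ; (inj₂ (here (inj₂ refl))) → visits (inj₁ (proj₂ ends))
             ; (inj₂ (there p)) → visits (inj₂ p) }
    where
    open ComplementaryPath P
    V′ : Pred Face 0ℓ
    V′ φ = φ ∈ V ⊎ φ ≡ face
    covered′ : ∀ {φ} → φ ∈ V′ → ∀ {x} → x ∈ vertices (boundary φ) → x ∈ vertices σ ⊎ x ∈ vertices path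
    covered′ (inj₁ φ∈) x∈ = inj₁ (covered φ∈ x∈)
    covered′ (inj₂ refl) x∈ with proj₁ (proj₁ bounds) x∈
    ... | inj₁ p = inj₂ p
    ... | inj₂ (here refl) = inj₂ (here refl)
    ... | inj₂ (there (here refl)) = inj₂ (there (∈-++⁺ʳ interior (here refl)))
    sided′ : ∀ {d} → (d ∈ edges σ ⊎ d ∈ edges path) × ¬ SameEdge d e → left d ∈ V′ ⊎ right Γ d ∈ V′
    sided′ (inj₁ d∈ , _) = ⊎-map inj₁ inj₁ (sided d∈)
    sided′ (inj₂ d∈ , _) = ⊎-map inj₂ inj₂ (proj₂ (proj₂ (proj₂ bounds) (inj₁ d∈)))
    face∉V : face ∉ V
    face∉V f∈ = let x , x∈ , x∉ = some-interior P in x∉ (covered f∈ x∈)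
    ends : left e ∈ V′ × right Γ e ∈ V′
    ends with sided e∈ | proj₂ (proj₂ (proj₂ bounds) (inj₂ (here (inj₁ refl))))
    ... | inj₁ l∈ | inj₁ refl = ⊥-elim (face∉V l∈)
    ... | inj₁ l∈ | inj₂ r≡ = inj₁ l∈ , inj₂ r≡
    ... | inj₂ r∈ | inj₁ l≡ = inj₂ l≡ , inj₁ r∈
    ... | inj₂ r∈ | inj₂ refl = ⊥-elim (face∉V r∈)

  tree⇒hamiltonian : BoundedByCycle Γ outer → (r : Run Γ) → MeetsEveryVertex Γ (runTree Γ r) → HasHamiltonianCycle
  tree⇒hamiltonian cyc r meets = proj₁ final , λ v → hamiltonian v (neighbour v)
    where
    final = run-cycle (_≡ outer) cyc (λ { refl v∈ → v∈ }) proj₂ r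
    hamiltonian : ∀ v → (∃ λ a → Adj v a) → v ∈ vertices (cycleGraph (proj₁ final))
    -- The faces around `v` are those to the left of the three darts leaving `v`; one of them is
    -- visited, and the final cycle passes through all its vertices.
    hamiltonian v (a , va) with meets v (left (v , a)) (left (v , b)) (left (v , c)) (λ φ → mk⇔ to from)
      where
      b = rot v a
      c = rot v b
      to : ∀ {φ} → v ∈ vertices (boundary φ) → φ ∈ₗ map (λ w → left (v , w)) (a ∷ b ∷ c ∷ [])
      to (w , vw , refl) = ∈-map⁺ _ (around va vw)
      from : ∀ {φ} → φ ∈ₗ map (λ w → left (v , w)) (a ∷ b ∷ c ∷ []) → v ∈ vertices (boundary φ)
      from (here refl) = a , va , refl
      from (there (here refl)) = b , rot-adj va , refl
      from (there (there (here refl))) = c , rot-adj (rot-adj va) , refl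
    ... | inj₁ p = proj₂ final p (a , va , refl)
    ... | inj₂ (inj₁ p) = proj₂ final p (rot v a , rot-adj va , refl)
    ... | inj₂ (inj₂ p) = proj₂ final p (_ , rot-adj (rot-adj va) , refl)

-- Hamiltonian cycles as cyclic permutations

module _ (G : SimpleGraph) where
  open SimpleGraph G

  -- The two neighbours of a vertex on the cycle become functions; `reach` says that `succ` has a
  -- single orbit.
  record Circuit : Set where
    field
      succ pred : Vertex → Vertex
      succ-pred : ∀ v → succ (pred v) ≡ v
      pred-succ : ∀ v → pred (succ v) ≡ v
      adj-succ  : ∀ v → Adj v (succ v)
      succ≢pred : ∀ v → succ v ≢ pred v
      origin     : Vertex
      reach     : ∀ v → Star (λ x y → succ x ≡ y) origin v

    adj-pred : ∀ v → Adj v (pred v)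
    adj-pred v = Adj-sym (subst (Adj (pred v)) (succ-pred v) (adj-succ (pred v)))

  circuit : (C : Cycle) → IsHamiltonian C → Circuit
  circuit C ham = record
    { succ = succ
    ; pred = pred
    ; succ-pred = λ v → target-unique (proj₂ (leaving (pred v))) (proj₂ (entering v))
    ; pred-succ = λ v → source-unique (proj₂ (entering (succ v))) (proj₂ (leaving v))
    ; adj-succ = λ v → linked⇒pairs linked (proj₂ (leaving v))
    ; succ≢pred = λ v e → no-2-cycle (proj₂ (leaving v)) (subst (λ w → (w , v) ∈ₗ ds) (sym e) (proj₂ (entering v)))
    ; origin = base
    ; reach = λ v → Star.map (target-unique (proj₂ (leaving _))) (reach v)
    }
    where
    open Cycle C
    ds : List Dart
    ds = pairs (base ∷ others ∷ʳ base)
    sources : map proj₁ ds ≡ base ∷ others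
    sources = pairs-map-proj₁ base others base
    targets : map proj₂ ds ≡ others ∷ʳ base
    targets = pairs-map-proj₂ base (others ∷ʳ base)
    on-cycle : ∀ v → v ∈ₗ base ∷ others
    on-cycle v with ∈-++⁻ (base ∷ others) (ham v)
    ... | inj₁ p = p
    ... | inj₂ (here e) = here e
    target-unique : ∀ {v u w} → (v , u) ∈ₗ ds → (v , w) ∈ₗ ds → u ≡ w
    target-unique p q = cong proj₂ (map-injective⁻ proj₁ (subst Unique (sym sources) distinct) p q refl)
    source-unique : ∀ {v u w} → (u , v) ∈ₗ ds → (w , v) ∈ₗ ds → u ≡ w
    source-unique p q = cong proj₁ (map-injective⁻ proj₂
      (subst Unique (sym targets) (unique-resp-↭ (++-comm (base ∷ []) others) distinct)) p q refl)
    leaving : ∀ v → ∃ λ w → (v , w) ∈ₗ ds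
    leaving v with ∈-map⁻ proj₁ (∈-resp-≡ (sym sources) (on-cycle v))
    ... | (_ , w) , d∈ , refl = w , d∈
    entering : ∀ v → ∃ λ w → (w , v) ∈ₗ ds
    entering v with ∈-map⁻ proj₂ (∈-resp-≡ (sym targets) (∈-resp-↭ (++-comm (base ∷ []) others) (on-cycle v)))
    ... | (w , _) , d∈ , refl = w , d∈
    succ pred : Vertex → Vertex
    succ v = proj₁ (leaving v)
    pred v = proj₁ (entering v)
    Arc : Rel Vertex 0ℓ
    Arc x y = (x , y) ∈ₗ ds
    reach-along : ∀ x xs {v} → v ∈ₗ x ∷ xs → Star (λ a b → (a , b) ∈ₗ pairs (x ∷ xs)) x v
    reach-along x xs (here refl) = ε
    reach-along x (y ∷ xs) (there p) = here refl ◅ Star.map there (reach-along y xs p)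
    reach : ∀ v → Star Arc base v
    reach v = reach-along base (others ∷ʳ base) (∈-++⁺ˡ (on-cycle v))
    pull-back : (P : Pred Vertex 0ℓ) → (∀ {x y} → Arc x y → P y → P x) → ∀ {x y} → Star Arc x y → P y → P x
    pull-back P h ε py = py
    pull-back P h (a ◅ s) py = h a (pull-back P h s py)
    push : (P : Pred Vertex 0ℓ) → (∀ {x y} → Arc x y → P x → P y) → ∀ {x y} → Star Arc x y → P x → P y
    push P h ε px = px
    push P h (a ◅ s) px = push P h s (h a px)
    -- Otherwise `v` and `w` form a set closed under arcs in both directions; it contains `base` and
    -- therefore every vertex, but the cycle has at least three.
    no-2-cycle : ∀ {v w} → Arc v w → ¬ Arc w v
    no-2-cycle {v} {w} vw wv = ℕ.<⇒≱ (s≤s long) (unique-⊆⇒length≤ distinct (λ {x} _ → everywhere x))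
      where
      P : Pred Vertex 0ℓ
      P x = x ∈ₗ v ∷ w ∷ []
      back : ∀ {x y} → Arc x y → P y → P x
      back a (here refl) = there (here (source-unique a wv))
      back a (there (here refl)) = here (source-unique a vw)
      forth : ∀ {x y} → Arc x y → P x → P y
      forth a (here refl) = there (here (target-unique a vw))
      forth a (there (here refl)) = here (target-unique a wv)
      everywhere : ∀ x → P x
      everywhere x = push P forth (reach x) (pull-back P back (reach v) (here refl))

-- Chords, and two opposite bounds on the number of faces

module Chords {G : SimpleGraph} (cubic : SimpleGraph.Cubic G) (Γ : PlaneEmbedding G) (H : Circuit G) where
  open CubicPlane cubic Γ public
  open Circuit H public

  OnCircuit : Pred Dart 0ℓ
  OnCircuit (u , v) = v ≡ succ u ⊎ v ≡ pred u

  onCircuit? : Decidable OnCircuit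
  onCircuit? (u , v) = (v ≟ succ u) ⊎-dec (v ≟ pred u)

  onCircuit-swap : ∀ {d} → OnCircuit d → OnCircuit (swap d)
  onCircuit-swap (inj₁ refl) = inj₂ (sym (pred-succ _))
  onCircuit-swap (inj₂ refl) = inj₁ (sym (succ-pred _))

  Chord : Pred Dart 0ℓ
  Chord d = IsDart d × ¬ OnCircuit d

  chord? : Decidable Chord
  chord? d@(u , v) = Adj? u v ×-dec ¬? (onCircuit? d)

  chord-swap : ∀ {d} → Chord d → Chord (swap d)
  chord-swap (a , n) = Adj-sym a , n ∘ onCircuit-swap

  ChordOff : Dart → Pred Dart 0ℓ
  ChordOff e d = Chord d × ¬ SameEdge d e

  darts : List Dart
  darts = cartesianProduct (allFin order) (allFin order)

  ∈-darts : ∀ d → d ∈ₗ darts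
  ∈-darts (u , v) = ∈-cartesianProduct⁺ (∈-allFin u) (∈-allFin v)

  darts-unique : Unique darts
  darts-unique = Unique.cartesianProduct⁺ (Unique.allFin⁺ order) (Unique.allFin⁺ order)

  -- The dart with increasing ends, which is the one counted in `size`.
  orient : Dart → Dart
  orient d@(u , v) with u <? v
  ... | yes _ = d
  ... | no  _ = swap d

  orient-same : ∀ d → SameEdge (orient d) d
  orient-same (u , v) with u <? v
  ... | yes _ = inj₁ refl
  ... | no  _ = inj₂ refl

  Oriented : Pred Dart 0ℓ
  Oriented (u , v) = u Fin.< v × Adj u v

  orient-oriented : ∀ {d} → IsDart d → Oriented (orient d)
  orient-oriented {u , v} uv with u <? v | <-cmp u v
  ... | yes u<v | _ = u<v , uv
  ... | no ≮ | tri< u<v _ _ = ⊥-elim (≮ u<v)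
  ... | no _ | tri≈ _ u≡v _ = ⊥-elim (Adj-irrefl u≡v uv)
  ... | no _ | tri> _ _ v<u = v<u , Adj-sym uv

  orientedChord? : Decidable (λ d → Oriented d × Chord d)
  orientedChord? d@(u , v) = ((u <? v) ×-dec Adj? u v) ×-dec chord? d

  chords : List Dart
  chords = filter orientedChord? darts

  ∈-chords⁻ : ∀ {d} → d ∈ₗ chords → Oriented d × Chord d
  ∈-chords⁻ = proj₂ ∘ ∈-filter⁻ orientedChord? {xs = darts}

  orient-∈-chords : ∀ {d} → Chord d → orient d ∈ₗ chords
  orient-∈-chords {d} c = ∈-filter⁺ orientedChord? (∈-darts (orient d)) (orient-oriented (proj₁ c) , chord)
    where
    chord : Chord (orient d)
    chord with orient d | orient-same d
    ... | _ | inj₁ refl = c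
    ... | _ | inj₂ refl = chord-swap c

  circuitEdges : List Dart
  circuitEdges = map (λ v → orient (v , succ v)) (allFin order)

  circuitEdges-unique : Unique circuitEdges
  circuitEdges-unique = Unique.map⁺ inj (Unique.allFin⁺ order)
    where
    inj : ∀ {v w} → orient (v , succ v) ≡ orient (w , succ w) → v ≡ w
    inj {v} {w} e with same-trans (same-sym (orient-same (v , succ v)))
                                  (subst (λ d → SameEdge d (w , succ w)) (sym e) (orient-same (w , succ w)))
    ... | inj₁ q = cong proj₁ q
    -- If the edges agree in opposite directions, then `w` both follows and precedes `v`.
    ... | inj₂ q = ⊥-elim (succ≢pred v (begin
      succ v              ≡⟨ cong proj₂ q ⟩
      w                   ≡⟨ pred-succ w ⟨
      pred (succ w)       ≡⟨ cong (pred ∘ proj₁) q ⟨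
      pred v              ∎))
      where open ≡-Reasoning

  edges-unique : Unique (circuitEdges ++ chords)
  edges-unique = Unique.++⁺ circuitEdges-unique (Unique.filter⁺ orientedChord? darts-unique) disjoint
    where
    disjoint : ∀ {d} → d ∈ₗ circuitEdges × d ∈ₗ chords → ⊥
    disjoint (p , q) with ∈-map⁻ (λ v → orient (v , succ v)) p
    ... | v , _ , refl with orient (v , succ v) | orient-same (v , succ v) | proj₂ (∈-chords⁻ q)
    ... | _ | inj₁ refl | c = proj₂ c (inj₁ refl)
    ... | _ | inj₂ refl | c = proj₂ c (onCircuit-swap (inj₁ refl))

  -- The circuit contributes one edge for each vertex.
  order+chords≤size : order + length chords ≤ size
  order+chords≤size = subst (_≤ size) lengths
    (unique-⊆⇒length≤ edges-unique (λ {d} d∈ → ∈-filter⁺ _ (∈-darts d) (oriented d∈)))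
    where
    oriented : ∀ {d} → d ∈ₗ circuitEdges ++ chords → Oriented d
    oriented d∈ with ∈-++⁻ circuitEdges d∈
    ... | inj₁ p with ∈-map⁻ (λ v → orient (v , succ v)) p
    ...   | v , _ , refl = orient-oriented (adj-succ v)
    oriented d∈ | inj₂ p = proj₁ (∈-chords⁻ p)
    lengths : length (circuitEdges ++ chords) ≡ order + length chords
    lengths = trans (length-++ circuitEdges) (cong (_+ length chords)
                (trans (length-map _ (allFin order)) (length-tabulate {n = order} id)))

  -- Euler's formula, with at least one component because there is the vertex `origin`.
  chords+2≤faces : length chords + 2 ≤ faces
  chords+2≤faces = ℕ.+-cancelˡ-≤ order _ _ (begin
    order + (length chords + 2)   ≡⟨ ℕ.+-assoc order _ 2 ⟨
    order + length chords + 2     ≤⟨ ℕ.+-mono-≤ order+chords≤size ℕ.≤-refl ⟩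
    size + 2                      ≡⟨ ℕ.+-assoc size 1 1 ⟨
    size + 1 + 1                  ≤⟨ ℕ.+-monoˡ-≤ 1 (ℕ.+-monoʳ-≤ size (nonempty (component origin))) ⟩
    size + components + 1         ≡⟨ euler ⟨
    order + faces                 ∎)
    where
    open ℕ.≤-Reasoning
    nonempty : ∀ {n} → Fin n → 1 ≤ n
    nonempty {suc n} _ = s≤s z≤n

  -- The labels are kept general because the bounds are applied twice: to the faces `left`, and to a
  -- refinement in which one orbit of the face-tracing map gets a label of its own.
  module Labelling {n : ℕ} (label : Dart → Fin n)
                   (trace : ∀ {u v} → Adj u v → label (u , v) ≡ label (v , rot v u))
                   (onto : ∀ φ → ∃ λ u → ∃ λ v → Adj u v × label (u , v) ≡ φ) where

    -- Adjacency in the dual graph, restricted to dual edges of darts in `D`.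
    Via : Pred Dart 0ℓ → Rel (Fin n) 0ℓ
    Via D x y = ∃ λ d → d ∈ D × label d ≡ x × label (swap d) ≡ y

    via-sym : ∀ {D} → (∀ {d} → d ∈ D → swap d ∈ D) → Symmetric (Via D)
    via-sym closed (d , d∈ , p , q) = swap d , closed d∈ , q , p

    -- On each side of the path p v q either there is a single corner at v, or the chord at v separates two.
    turn : ∀ {v p q} → Adj v p → Adj v q → p ≢ q →
           (∀ {w} → Adj v w → w ≢ p → w ≢ q → Chord (v , w)) →
           Star (Via Chord) (label (p , v)) (label (v , q))
    turn {v} {p} {q} vp vq p≢q third with rot v p ≟ q
    ... | yes refl = subst (Star (Via Chord) _) (trace (Adj-sym vp)) ε
    ... | no rp≢q = ((v , t) , third vt (rot≢ vp) rp≢q , sym (trace (Adj-sym vp)) ,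
                     trans (trace (Adj-sym vt)) (cong (λ w → label (v , w)) rt≡q)) ◅ ε
      where
      t = rot v p
      vt = rot-adj vp
      rt≡q : rot v t ≡ q
      rt≡q with around vp vq
      ... | here e = ⊥-elim (p≢q (sym e))
      ... | there (here e) = ⊥-elim (rp≢q (sym e))
      ... | there (there (here e)) = sym e

    connected-left : ∀ v → Star (Via Chord) (label (v , succ v)) (label (succ v , succ (succ v)))
    connected-left v = subst (λ p → Star (Via Chord) (label (p , succ v)) (label (succ v , succ (succ v)))) (pred-succ v)
      (turn (adj-pred w) (adj-succ w) (succ≢pred w ∘ sym) (λ a ≢p ≢s → a , [ ≢s , ≢p ]′))
      where w = succ v

    connected-right : ∀ v → Star (Via Chord) (label (succ (succ v) , succ v)) (label (succ v , v))
    connected-right v = subst (λ p → Star (Via Chord) (label (succ (succ v) , succ v)) (label (succ v , p))) (pred-succ v)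
      (turn (adj-succ w) (adj-pred w) (succ≢pred w) (λ a ≢s ≢p → a , [ ≢s , ≢p ]′))
      where w = succ v

    reversed : ∀ {D} → (∀ {d} → d ∈ D → swap d ∈ D) → Symmetric (Star (Via D))
    reversed closed = Star.reverse (via-sym closed)

    leftRoot rightRoot : Fin n
    leftRoot = label (origin , succ origin)
    rightRoot = label (succ origin , origin)

    left-sides : ∀ v → Star (Via Chord) (label (v , succ v)) leftRoot
    left-sides v = go (reach v)
      where
      go : ∀ {x v} → Star (λ a b → succ a ≡ b) x v → Star (Via Chord) (label (v , succ v)) (label (x , succ x))
      go ε = ε
      go (refl ◅ s) = go s ◅◅ reversed chord-swap (connected-left _)

    right-sides : ∀ v → Star (Via Chord) (label (succ v , v)) rightRoot
    right-sides v = go (reach v)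
      where
      go : ∀ {x v} → Star (λ a b → succ a ≡ b) x v → Star (Via Chord) (label (succ v , v)) (label (succ x , x))
      go ε = ε
      go (refl ◅ s) = go s ◅◅ connected-right _

    Rooted : Pred (Fin n) 0ℓ
    Rooted φ = Star (Via Chord) φ leftRoot ⊎ Star (Via Chord) φ rightRoot

    rooted-succ : ∀ v → Rooted (label (v , succ v))
    rooted-succ v = inj₁ (left-sides v)

    rooted-succ⁻ : ∀ v → Rooted (label (succ v , v))
    rooted-succ⁻ v = inj₂ (right-sides v)

    rooted-onCircuit : ∀ {d} → OnCircuit d → Rooted (label d)
    rooted-onCircuit {u , v} (inj₁ refl) = rooted-succ u
    rooted-onCircuit {u , v} (inj₂ refl) = subst (λ w → Rooted (label (w , pred u))) (succ-pred u) (rooted-succ⁻ (pred u))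

    -- Two of the three edges at a vertex lie on the circuit. If `(x , w)` is a chord, the edge
    -- `xw′` before it in the rotation is therefore on the circuit, and face tracing leads from
    -- `(w′ , x)` to `(x , w)`.
    rooted-dart : ∀ {d} → IsDart d → Rooted (label d)
    rooted-dart {x , w} xw with onCircuit? (x , w)
    ... | yes h = rooted-onCircuit h
    ... | no ¬h = subst Rooted (trans (trace (Adj-sym xw′)) (cong (λ y → label (x , y)) (rot³ xw)))
                    (rooted-onCircuit (onCircuit-swap onCircuit))
      where
      w′ = rot x (rot x w)
      xw′ = rot-adj (rot-adj xw)
      onCircuit : OnCircuit (x , w′)
      onCircuit with around xw (adj-succ x) | around xw (adj-pred x)
      ... | here e | _ = ⊥-elim (¬h (inj₁ (sym e)))
      ... | _ | here e = ⊥-elim (¬h (inj₂ (sym e)))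
      ... | there (there (here e)) | _ = inj₁ (sym e)
      ... | _ | there (there (here e)) = inj₂ (sym e)
      ... | there (here e) | there (here e′) = ⊥-elim (succ≢pred x (trans e (sym e′)))

    rooted : ∀ φ → Rooted φ
    rooted φ = let u , v , uv , e = onto φ in subst Rooted e (rooted-dart uv)

    ends : Dart → Fin n × Fin n
    ends d = label d , label (swap d)

    -- The bound `order≤edges+roots` for the dual graph; `ds` needs only one dart of each edge.
    count : (D : Pred Dart 0ℓ) (ds : List Dart) → (∀ {d} → d ∈ D → ∃ λ e → e ∈ₗ ds × SameEdge e d) →
            ∀ rs → (∀ φ → ∃ λ r → r ∈ₗ rs × Star (Via D) φ r) → n ≤ length ds + length rs
    count D ds list rs root = subst (λ m → n ≤ m + length rs) (length-map ends ds)
      (order≤edges+roots (map ends ds) rs λ φ → let r , r∈ , p = root φ in r , r∈ , Star.map link p)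
      where
      link : ∀ {x y} → Via D x y → LinkOf (map ends ds) x y
      link (d , d∈ , refl , refl) with list d∈
      ... | _ , e∈ , inj₁ refl = inj₁ (∈-map⁺ ends e∈)
      ... | _ , e∈ , inj₂ refl = inj₂ (∈-map⁺ ends e∈)

    oriented-chord : ∀ {d} → d ∈ Chord → ∃ λ e → e ∈ₗ chords × SameEdge e d
    oriented-chord {d} c = orient d , orient-∈-chords c , orient-same d

    labels≤ : n ≤ length chords + 2
    labels≤ = count Chord chords oriented-chord (leftRoot ∷ rightRoot ∷ []) λ φ →
      [ (λ p → _ , here refl , p) , (λ p → _ , there (here refl) , p) ]′ (rooted φ)

    sides-joined⇒labels≤ : Star (Via Chord) leftRoot rightRoot → n ≤ length chords + 1
    sides-joined⇒labels≤ joined = count Chord chords oriented-chord (rightRoot ∷ []) λ φ →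
      _ , here refl , [ _◅◅ joined , id ]′ (rooted φ)

    chord-bypassed⇒labels≤ : ∀ {e} → Chord e → Star (Via (ChordOff e)) (label e) (label (swap e)) →
                             suc n ≤ length chords + 2
    chord-bypassed⇒labels≤ {e} ce bypass = ℕ.≤-trans
      (s≤s (count (ChordOff e) others list (leftRoot ∷ rightRoot ∷ []) root))
      (ℕ.+-monoˡ-≤ 2 (filter-notAll off? chords (Any.map (λ { refl ¬s → ¬s (orient-same e) }) (orient-∈-chords ce))))
      where
      off? : Decidable (λ d → ¬ SameEdge d e)
      off? d = ¬? (same-edge? d e)
      others = filter off? chords
      list : ∀ {d} → d ∈ ChordOff e → ∃ λ d′ → d′ ∈ₗ others × SameEdge d′ d
      list {d} (c , ≢e) = orient d , ∈-filter⁺ off? (orient-∈-chords c) (λ s → ≢e (same-trans (same-sym (orient-same d)) s)) ,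
                          orient-same d
      off-swap : ∀ {d} → ChordOff e d → ChordOff e (swap d)
      off-swap (c , ≢e) = chord-swap c , ≢e ∘ same-swapˡ
      detour : ∀ {x y} → Via Chord x y → Star (Via (ChordOff e)) x y
      detour (d , c , p , q) with same-edge? d e
      detour (d , c , refl , refl) | yes (inj₁ refl) = bypass
      detour (d , c , refl , refl) | yes (inj₂ refl) = reversed off-swap bypass
      ... | no ≢e = (d , (c , ≢e) , p , q) ◅ ε
      root : ∀ φ → ∃ λ r → r ∈ₗ (leftRoot ∷ rightRoot ∷ []) × Star (Via (ChordOff e)) φ r
      root φ = [ (λ p → _ , here refl , (detour Star.⋆) p) , (λ p → _ , there (here refl) , (detour Star.⋆) p) ]′ (rooted φ)

-- Faces of a Hamiltonian cubic plane graph are bounded by cycles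

module Faces {G : SimpleGraph} (cubic : SimpleGraph.Cubic G) (Γ : PlaneEmbedding G) (H : Circuit G) where
  open Chords cubic Γ H public
  open Labelling left left-trace left-onto public

  -- The two bounds on the number of faces leave no room for a redundant chord; that is, the dual
  -- edges of the chords form a forest.
  chord-not-bypassed : ∀ {e} → Chord e → ¬ Star (Via (ChordOff e)) (left e) (left (swap e))
  chord-not-bypassed c p = ℕ.<⇒≱ (chord-bypassed⇒labels≤ c p) chords+2≤faces

  -- If the two sides of the circuit were joined, one root would suffice and there would be one face
  -- too few.
  succ-separates : ∀ v → ¬ Star (Via Chord) (left (v , succ v)) (left (succ v , v))
  succ-separates v p = ℕ.<⇒≱ (ℕ.≤-trans (ℕ.≤-reflexive (sym (ℕ.+-suc _ 1))) chords+2≤faces)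
    (sides-joined⇒labels≤ (reversed chord-swap (left-sides v) ◅◅ p ◅◅ right-sides v))

  circuit-separates : ∀ {d} → OnCircuit d → ¬ Star (Via Chord) (left d) (left (swap d))
  circuit-separates {u , _} (inj₁ refl) p = succ-separates u p
  circuit-separates {u , _} (inj₂ refl) p = succ-separates (pred u)
    (subst (λ v → Star (Via Chord) (left (pred u , v)) (left (v , pred u))) (sym (succ-pred u)) (reversed chord-swap p))

  -- If both sides were the same face, the empty path would join the two sides of a circuit edge or
  -- bypass a chord.
  no-bridge : ∀ {d} → IsDart d → left d ≢ left (swap d)
  no-bridge {d} uv e with onCircuit? d
  ... | yes h = circuit-separates h (subst (Star (Via Chord) (left d)) e ε)
  ... | no ¬h = chord-not-bypassed (uv , ¬h) (subst (Star (Via (ChordOff d)) (left d)) e ε)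

  -- Two corners of `p` are separated by one edge, which would have the same face on both sides.
  -- Hence a face walk visits each vertex at most once.
  source-injective : ∀ {p a b} → Adj p a → Adj p b → left (p , a) ≡ left (p , b) → a ≡ b
  source-injective {p} {a} {b} pa pb e with a ≟ b
  ... | yes a≡b = a≡b
  ... | no a≢b with adjacent-corners pa pb a≢b
  ... | inj₁ refl = ⊥-elim (no-bridge pa (trans e (sym (left-trace (Adj-sym pa)))))
  ... | inj₂ refl = ⊥-elim (no-bridge pb (trans (sym e) (sym (left-trace (Adj-sym pb)))))

  Follows : Rel Dart 0ℓ
  Follows d e = next d ≡ e

  chain-next : ∀ ds {d₀ x} → Linked Follows (ds ∷ʳ d₀) → x ∈ₗ ds ∷ʳ d₀ → x ≡ d₀ ⊎ next x ∈ₗ drop 1 (ds ∷ʳ d₀)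
  chain-next [] l (here e) = inj₁ e
  chain-next (d ∷ []) (refl ∷ l) (here refl) = inj₂ (here refl)
  chain-next (d ∷ d′ ∷ ds) (refl ∷ l) (here refl) = inj₂ (here refl)
  chain-next (d ∷ []) l (there (here e)) = inj₁ e
  chain-next (d ∷ d′ ∷ ds) (_ ∷ l) (there p) = ⊎-map id there (chain-next (d′ ∷ ds) l p)

  chain-prev : ∀ ds {y} → Linked Follows ds → y ∈ₗ drop 1 ds → ∃ λ x → x ∈ₗ ds × next x ≡ y
  chain-prev (d ∷ _ ∷ ds) (e ∷ l) (here refl) = d , here refl , e
  chain-prev (d ∷ d′ ∷ ds) (e ∷ l) (there p) = let x , x∈ , q = chain-prev (d′ ∷ ds) l p in x , there x∈ , q

  chain-left : ∀ ds {d₀ x} → Linked Follows (ds ∷ʳ d₀) → All IsDart (ds ∷ʳ d₀) → x ∈ₗ ds ∷ʳ d₀ → left x ≡ left d₀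
  chain-left [] l a (here refl) = refl
  chain-left (d ∷ []) (refl ∷ l) (a ∷ _) (here refl) = left-trace a
  chain-left (d ∷ d′ ∷ ds) (refl ∷ l) (a ∷ as) (here refl) = trans (left-trace a) (chain-left (d′ ∷ ds) l as (here refl))
  chain-left (d ∷ ds) l (_ ∷ as) (there p) = chain-left ds (Linked.tail l) as p

  chain-pairs : ∀ ds {d₀} → Linked Follows (ds ∷ʳ d₀) → pairs (map proj₁ (ds ∷ʳ d₀)) ≡ ds
  chain-pairs [] l = refl
  chain-pairs (d ∷ []) (refl ∷ l) = refl
  chain-pairs (d ∷ d′ ∷ ds) (refl ∷ l) = cong (d ∷_) (chain-pairs (d′ ∷ ds) l)

  -- The orbit of `d₀` under face tracing, listed from `next d₀` on. With `d₀` last, `initial`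
  -- consists of the darts of the path left after removing the edge of `d₀`.
  record FaceWalk (d₀ : Dart) : Set where
    field
      initial  : List Dart
      rest     : List Dart
      closing  : initial ∷ʳ d₀ ≡ next d₀ ∷ rest
      chain    : Linked Follows (initial ∷ʳ d₀)
      darts-of : All IsDart (initial ∷ʳ d₀)
      unique   : Unique (initial ∷ʳ d₀)

    walk : List Dart
    walk = initial ∷ʳ d₀

    last∈ : d₀ ∈ₗ walk
    last∈ = ∈-++⁺ʳ initial (here refl)

    walk-next : ∀ {x} → x ∈ₗ walk → next x ∈ₗ walk
    walk-next x∈ with chain-next initial chain x∈
    ... | inj₁ refl = ∈-resp-≡ (sym closing) (here refl)
    ... | inj₂ p = ∈-resp-≡ (sym closing) (there (∈-resp-≡ (cong (drop 1) closing) p))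

    walk-prev : ∀ {x} → IsDart x → next x ∈ₗ walk → x ∈ₗ walk
    walk-prev {x} xd p with ∈-resp-≡ closing p
    ... | here e = subst (_∈ₗ walk) (trans (sym (prev-next (All.lookup darts-of last∈))) (trans (cong prev (sym e)) (prev-next xd))) last∈
    ... | there q with chain-prev walk chain (∈-resp-≡ (cong (drop 1) (sym closing)) q)
    ... | y , y∈ , e = subst (_∈ₗ walk) (trans (sym (prev-next (All.lookup darts-of y∈))) (trans (cong prev e) (prev-next xd))) y∈

    walk-left : ∀ {x} → x ∈ₗ walk → left x ≡ left d₀
    walk-left = chain-left initial chain darts-of

    -- Otherwise splitting off the orbit as a face of its own would give a labelling with too many labels.
    walk-complete : ∀ {x} → IsDart x → left x ≡ left d₀ → x ∈ₗ walk
    walk-complete {x} xd left≡ = decidable-stable (∈walk? x) λ x∉ →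
      ℕ.<⇒≱ (Labelling.labels≤ label trace (onto x∉)) chords+2≤faces
      where
      ∈walk? : Decidable (_∈ₗ walk)
      ∈walk? y = Any.any? (≡-dec _≟_ _≟_ y) walk
      label : Dart → Fin (suc faces)
      label y with ∈walk? y
      ... | yes _ = zero
      ... | no _ = suc (left y)
      trace : ∀ {u v} → Adj u v → label (u , v) ≡ label (v , rot v u)
      trace {u} {v} uv with ∈walk? (u , v) | ∈walk? (v , rot v u)
      ... | yes _ | yes _ = refl
      ... | no _ | no _ = cong suc (left-trace uv)
      ... | yes p | no ¬q = ⊥-elim (¬q (walk-next p))
      ... | no ¬p | yes q = ⊥-elim (¬p (walk-prev uv q))
      label-inside : ∀ {y} → y ∈ₗ walk → label y ≡ zero
      label-inside {y} p with ∈walk? y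
      ... | yes _ = refl
      ... | no ¬p = ⊥-elim (¬p p)
      label-outside : ∀ {y} → ¬ y ∈ₗ walk → label y ≡ suc (left y)
      label-outside {y} ¬p with ∈walk? y
      ... | yes p = ⊥-elim (¬p p)
      ... | no _ = refl
      onto : ¬ x ∈ₗ walk → ∀ φ → ∃ λ u → ∃ λ v → Adj u v × label (u , v) ≡ φ
      onto x∉ zero = proj₁ d₀ , proj₂ d₀ , All.lookup darts-of last∈ , label-inside last∈
      onto x∉ (suc φ) with left-onto φ
      ... | u , v , uv , refl with ∈walk? (u , v)
      -- After the splitting, the old label of the face of `d₀` is still attained, at `x`.
      ... | yes p = proj₁ x , proj₂ x , xd , trans (label-outside x∉) (cong suc (trans left≡ (sym (walk-left p))))
      ... | no ¬p = u , v , uv , label-outside ¬p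

  private
    -- Predecessors are prepended until one repeats. The darts listed are distinct, so their total
    -- number bounds the rounds, which `k` counts down.
    grow : ∀ k {d₀} y zs init → y ∷ zs ≡ init ∷ʳ d₀ → Linked Follows (y ∷ zs) → All IsDart (y ∷ zs) →
           Unique (y ∷ zs) → length darts < k + length (y ∷ zs) → FaceWalk d₀
    grow zero y zs init e l a u bound = ⊥-elim (ℕ.<⇒≱ bound (unique-⊆⇒length≤ u (λ {x} _ → ∈-darts x)))
    grow (suc k) {d₀} y zs init e l a u bound with Any.any? (≡-dec _≟_ _≟_ (prev y)) (y ∷ zs)
    ... | no prev∉ = grow k (prev y) (y ∷ zs) (prev y ∷ init) (cong (prev y ∷_) e)
                       (next-prev (All.head a) ∷ l) (prev-isDart (All.head a) ∷ a) (unique-∷ prev∉ u)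
                       (subst (length darts <_) (sym (ℕ.+-suc k _)) bound)
    ... | yes prev∈ = record
      { initial = init ; rest = zs
      ; closing = trans (sym e) (cong (_∷ zs) (trans (sym (next-prev (All.head a))) (cong next prev≡d₀)))
      ; chain = subst (Linked Follows) e l ; darts-of = subst (All IsDart) e a ; unique = subst Unique e u }
      where
      -- A repeated dart before the end of the list would have its successor `y` at a later
      -- position, although the entries are distinct.
      prev≡d₀ : prev y ≡ d₀
      prev≡d₀ with chain-next init (subst (Linked Follows) e l) (∈-resp-≡ e prev∈)
      ... | inj₁ q = q
      ... | inj₂ q = ⊥-elim (unique-∉ u (subst₂ _∈ₗ_ (next-prev (All.head a)) (cong (drop 1) (sym e)) q))

  faceWalk : ∀ {d} → IsDart d → FaceWalk d
  faceWalk {d} a = grow (length darts) d [] [] refl [-] (a ∷ []) ([] ∷ [])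
    (subst (length darts <_) (ℕ.+-comm 1 (length darts)) ℕ.≤-refl)

  -- The part of a complementary path for `uv` that does not depend on σ; its face lies to the right
  -- of `(u , v)`.
  record FacePath (u v : Vertex) : Set where
    field
      interior      : List Vertex
      path-linked   : Linked Adj (u ∷ interior ∷ʳ v)
      path-distinct : Unique (u ∷ interior ∷ʳ v)
      bounds        : boundary (left (v , u)) ≋ walkGraph (u ∷ interior ∷ʳ v) ⊞ edgeGraph (u , v)

  -- The path consists of the sources of the darts in the walk that ends with `(v , u)`. They are
  -- distinct by `source-injective`, and by `walk-complete` the walk is the whole boundary.
  facePath : ∀ {u v} → Adj u v → FacePath u v
  facePath {u} {v} uv = from-shape (shape initial rest closing)
    where
    open FaceWalk (faceWalk (Adj-sym uv))
    shape : ∀ ds rest → ds ∷ʳ (v , u) ≡ next (v , u) ∷ rest → ∃ λ ms → map proj₁ (ds ∷ʳ (v , u)) ≡ u ∷ ms ∷ʳ v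
    -- A walk of a single dart would be a loop.
    shape [] _ e = ⊥-elim (Adj-irrefl (sym (cong proj₁ (proj₁ (∷-injective e)))) uv)
    shape (d ∷ ds) _ e = map proj₁ ds , cong₂ _∷_ (cong proj₁ (proj₁ (∷-injective e))) (map-++ proj₁ ds _)
    from-shape : (∃ λ ms → map proj₁ walk ≡ u ∷ ms ∷ʳ v) → FacePath u v
    from-shape (ms , eq) = record
      { interior = ms
      ; path-linked = pairs⇒linked path λ p → All.lookup darts-of (∈-++⁺ˡ (∈-resp-≡ path-pairs p))
      ; path-distinct = subst Unique eq (map-unique⁺ proj₁ inj unique)
      ; bounds = (v⇒ , v⇐) , (e⇒ , e⇐)
      }
      where
      path = u ∷ ms ∷ʳ v
      φ = left (v , u)
      path-pairs : pairs path ≡ initial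
      path-pairs = trans (cong pairs (sym eq)) (chain-pairs initial chain)
      inj : ∀ {x y} → x ∈ₗ walk → y ∈ₗ walk → proj₁ x ≡ proj₁ y → x ≡ y
      inj {p , a} {_ , b} x∈ y∈ refl = cong (p ,_) (source-injective (All.lookup darts-of x∈) (All.lookup darts-of y∈)
                                         (trans (walk-left x∈) (sym (walk-left y∈))))
      v⇒ : ∀ {x} → x ∈ vertices (boundary φ) → x ∈ₗ path ⊎ x ∈ₗ u ∷ v ∷ []
      v⇒ (w , xw , e) = inj₁ (∈-resp-≡ eq (∈-map⁺ proj₁ (walk-complete xw e)))
      path⇒boundary : ∀ {x} → x ∈ₗ path → x ∈ vertices (boundary φ)
      path⇒boundary p with ∈-map⁻ proj₁ (∈-resp-≡ (sym eq) p)
      ... | (x , w) , d∈ , refl = w , All.lookup darts-of d∈ , walk-left d∈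
      v⇐ : ∀ {x} → x ∈ₗ path ⊎ x ∈ₗ u ∷ v ∷ [] → x ∈ vertices (boundary φ)
      v⇐ (inj₁ p) = path⇒boundary p
      v⇐ (inj₂ (here refl)) = path⇒boundary (here refl)
      v⇐ (inj₂ (there (here refl))) = path⇒boundary (there (∈-++⁺ʳ ms (here refl)))
      walk⇒edges : ∀ {d x} → SameEdge x d → d ∈ₗ walk → Any (SameEdge x) (pairs path) ⊎ Any (SameEdge x) ((u , v) ∷ [])
      walk⇒edges s d∈ with ∈-++⁻ initial d∈
      ... | inj₁ p = inj₁ (subst (Any _) (sym path-pairs) (Any.map (λ { refl → s }) p))
      ... | inj₂ (here refl) = inj₂ (here (⊎-swap s))
      e⇒ : ∀ {d} → d ∈ edges (boundary φ) → Any (SameEdge d) (pairs path) ⊎ Any (SameEdge d) ((u , v) ∷ [])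
      e⇒ (a , inj₁ e) = walk⇒edges (inj₁ refl) (walk-complete a e)
      e⇒ (a , inj₂ e) = walk⇒edges (inj₂ refl) (walk-complete (Adj-sym a) e)
      walk⇒boundary : ∀ {d x} → SameEdge x d → d ∈ₗ walk → x ∈ edges (boundary φ)
      walk⇒boundary (inj₁ refl) d∈ = All.lookup darts-of d∈ , inj₁ (walk-left d∈)
      walk⇒boundary (inj₂ refl) d∈ = Adj-sym (All.lookup darts-of d∈) , inj₂ (walk-left d∈)
      e⇐ : ∀ {d} → Any (SameEdge d) (pairs path) ⊎ Any (SameEdge d) ((u , v) ∷ []) → d ∈ edges (boundary φ)
      e⇐ (inj₁ p) with CycleSurgery.any-same⁻ G (subst (Any _) path-pairs p)
      ... | inj₁ d∈ = walk⇒boundary (inj₁ refl) (∈-++⁺ˡ d∈)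
      ... | inj₂ d∈ = walk⇒boundary (inj₂ refl) (∈-++⁺ˡ d∈)
      e⇐ (inj₂ (here s)) = walk⇒boundary (⊎-swap s) last∈

-- Exploring the tree of the outer face as a run

module Exploration {G : SimpleGraph} (cubic : SimpleGraph.Cubic G) (Γ : PlaneEmbedding G) (H : Circuit G) where
  open Faces cubic Γ H

  InTree : List Dart → Pred Dart 0ℓ
  InTree cs d = Any (SameEdge d) cs

  inTree-swap : ∀ {cs d} → InTree cs d → InTree cs (swap d)
  inTree-swap = Any.map same-swapˡ

  -- The invariants of the exploration, with visited faces `vis` and crossed chords `cs`. By
  -- `frontier` a chord leading to an unvisited face is an edge of σ, so it may be chosen.
  -- Acyclicity follows from `tree-edge`, since chords form a forest in the dual.
  record State (σ : Subgraph) (vis : List Face) (cs : List Dart) : Set where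
    field
      vis-unique : Unique vis
      outer∈     : outer ∈ₗ vis
      tree-edge  : ∀ {e} → e ∈ₗ cs → Chord e × left e ∈ₗ vis × left (swap e) ∈ₗ vis
      tree-path  : ∀ {φ} → φ ∈ₗ vis → Star (Via (InTree cs)) outer φ
      vertex⇒    : ∀ {x} → x ∈ vertices σ → ∃ λ φ → φ ∈ₗ vis × x ∈ vertices (boundary φ)
      vertex⇐    : ∀ {φ} → φ ∈ₗ vis → ∀ {x} → x ∈ vertices (boundary φ) → x ∈ vertices σ
      frontier   : ∀ {d} → IsDart d → left d ∈ₗ vis → ¬ left (swap d) ∈ₗ vis → d ∈ edges σ × swap d ∈ edges σ

    inTree : ∀ {d} → InTree cs d → Chord d × left d ∈ₗ vis × left (swap d) ∈ₗ vis
    inTree p with CycleSurgery.any-same⁻ G p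
    ... | inj₁ d∈ = tree-edge d∈
    ... | inj₂ d∈ = let c , l , r = tree-edge d∈ in chord-swap c , r , l

    tree-join : ∀ {φ ψ} → φ ∈ₗ vis → ψ ∈ₗ vis → Star (Via (InTree cs)) φ ψ
    tree-join φ∈ ψ∈ = reversed inTree-swap (tree-path φ∈) ◅◅ tree-path ψ∈

    chord-join : ∀ {φ ψ} → φ ∈ₗ vis → ψ ∈ₗ vis → Star (Via Chord) φ ψ
    chord-join φ∈ ψ∈ = Star.map (λ (d , d∈ , p , q) → d , proj₁ (inTree d∈) , p , q) (tree-join φ∈ ψ∈)

    -- Visited faces are joined by chords and so lie on the same side of the circuit.
    chord-between : ∀ {d} → IsDart d → left d ∈ₗ vis → left (swap d) ∈ₗ vis → Chord d
    chord-between a l r = a , λ h → circuit-separates h (chord-join l r)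

    -- If `d` and `e` differed, crossing `e` and going through the tree would join the sides of `d`
    -- while avoiding `d`, as tree edges have visited faces on both sides. This is impossible for
    -- circuit edges and for chords.
    attaching-unique : ∀ {d e} → IsDart d → Chord e → ¬ left d ∈ₗ vis → left (swap d) ∈ₗ vis →
                       left e ∈ₗ vis → left (swap e) ≡ left d → SameEdge d e
    attaching-unique {d} {e} a ce l∉ r∈ el∈ er≡ with same-edge? d e
    ... | yes s = s
    ... | no ≢e with onCircuit? d
    ... | yes h = ⊥-elim (circuit-separates h ((swap e , chord-swap ce , er≡ , refl) ◅ chord-join el∈ r∈))
    ... | no ¬h = ⊥-elim (chord-not-bypassed (a , ¬h)
            ((swap e , (chord-swap ce , ≢e ∘ same-sym ∘ same-swapˡ) , er≡ , refl)
             ◅ Star.map (λ (x , x∈ , p , q) → x , (proj₁ (inTree x∈) , off x∈) , p , q) (tree-join el∈ r∈)))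
      where
      off : ∀ {x} → InTree cs x → ¬ SameEdge x d
      off x∈ (inj₁ refl) = l∉ (proj₁ (proj₂ (inTree x∈)))
      off x∈ (inj₂ refl) = l∉ (proj₂ (proj₂ (inTree x∈)))

  Closed : List Face → Set
  Closed vis = ∀ {d} → Chord d → left d ∈ₗ vis → left (swap d) ∈ₗ vis

  closed-via : ∀ {vis} → Closed vis → ∀ {φ ψ} → Star (Via Chord) φ ψ → φ ∈ₗ vis → ψ ∈ₗ vis
  closed-via closed ε φ∈ = φ∈
  closed-via closed ((d , c , refl , refl) ◅ p) φ∈ = closed-via closed p (closed c φ∈)

  -- A closed set containing the outer face contains all faces on one side of the circuit, and each
  -- side has a corner at every vertex.
  closed-meets : ∀ {vis} → Closed vis → outer ∈ₗ vis → ∀ v → ∃ λ φ → φ ∈ₗ vis × v ∈ vertices (boundary φ)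
  closed-meets closed outer∈ v with rooted outer
  ... | inj₁ p = left (v , succ v) , closed-via closed (p ◅◅ reversed chord-swap (left-sides v)) outer∈ , succ v , adj-succ v , refl
  ... | inj₂ p = left (succ v , v) , closed-via closed (p ◅◅ reversed chord-swap (right-sides v)) outer∈ ,
                 rot v (succ v) , rot-adj (adj-succ v) , sym (left-trace (Adj-sym (adj-succ v)))

  initial-state : State (boundary outer) (outer ∷ []) []
  initial-state = record
    { vis-unique = [] ∷ []
    ; outer∈ = here refl
    ; tree-edge = λ ()
    ; tree-path = λ { (here refl) → ε }
    ; vertex⇒ = λ x∈ → outer , here refl , x∈
    ; vertex⇐ = λ { (here refl) x∈ → x∈ }
    ; frontier = λ { a (here e) _ → (a , inj₁ e) , (Adj-sym a , inj₂ e) }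
    }

  module Extend {σ vis cs} (S : State σ vis cs) {u v} (chord : Chord (u , v))
                (visited : left (u , v) ∈ₗ vis) (unvisited : ¬ left (v , u) ∈ₗ vis) where
    open State S

    e : Dart
    e = u , v

    new : Face
    new = left (v , u)

    e∈σ : e ∈ edges σ
    e∈σ = proj₁ (frontier (proj₁ chord) visited unvisited)

    open FacePath (facePath (proj₁ chord))

    -- A vertex `x` of σ has a corner in a visited face. An edge at `x` separates it from the corner
    -- of `new`, and by `attaching-unique` this edge is the chord `uv`.
    new-meets-σ-at-ends : ∀ {x} → x ∈ vertices (boundary new) → x ∈ vertices σ → x ≡ u ⊎ x ≡ v
    new-meets-σ-at-ends {x} (a , xa , a≡) x∈σ with vertex⇒ x∈σ
    ... | ψ , ψ∈ , b , xb , refl with adjacent-corners xa xb (λ { refl → unvisited (subst (_∈ₗ vis) a≡ ψ∈) })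
    ... | inj₁ refl = ends-of (attaching-unique xa chord (unvisited ∘ subst (_∈ₗ vis) a≡)
                              (subst (_∈ₗ vis) (sym (left-trace (Adj-sym xa))) ψ∈) visited (sym a≡))
      where
      ends-of : SameEdge (x , a) e → x ≡ u ⊎ x ≡ v
      ends-of (inj₁ refl) = inj₁ refl
      ends-of (inj₂ refl) = inj₂ refl
    ... | inj₂ refl = ends-of (attaching-unique (Adj-sym xb) chord (unvisited ∘ subst (_∈ₗ vis) b≡) ψ∈ visited (sym b≡))
      where
      b≡ : left (b , x) ≡ new
      b≡ = trans (left-trace (Adj-sym xb)) a≡
      ends-of : SameEdge (b , x) e → x ≡ u ⊎ x ≡ v
      ends-of (inj₁ refl) = inj₂ refl
      ends-of (inj₂ refl) = inj₁ refl

    interior-disjoint : All (_∉ vertices σ) interior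
    interior-disjoint = All.tabulate λ {x} x∈ x∈σ →
      [ (λ { refl → unique-∉ path-distinct (∈-++⁺ˡ x∈) })
      , (λ { refl → unique-∉ (unique-∷ʳ (u ∷ interior) path-distinct) (there x∈) }) ]′
      (new-meets-σ-at-ends (proj₂ (proj₁ bounds) (inj₁ (there (∈-++⁺ˡ x∈)))) x∈σ)

    complementaryPath : ComplementaryPath Γ σ e
    complementaryPath = record
      { interior = interior
      ; path-linked = path-linked
      ; path-distinct = path-distinct
      ; internally-disjoint = interior-disjoint
      ; face = new
      ; bounds = bounds
      }

    extended : State (σ ⊞ ComplementaryPath.path complementaryPath ⊟ e) (new ∷ vis) (cs ∷ʳ e)
    extended = record
      { vis-unique = unique-∷ unvisited vis-unique
      ; outer∈ = there outer∈
      ; tree-edge = tree-edge′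
      ; tree-path = tree-path′
      ; vertex⇒ = vertex⇒′
      ; vertex⇐ = vertex⇐′
      ; frontier = frontier′
      }
      where
      tree-edge′ : ∀ {d} → d ∈ₗ cs ∷ʳ e → Chord d × left d ∈ₗ new ∷ vis × left (swap d) ∈ₗ new ∷ vis
      tree-edge′ d∈ with ∈-++⁻ cs d∈
      ... | inj₁ p = let c , l , r = tree-edge p in c , there l , there r
      ... | inj₂ (here refl) = chord , there visited , here refl
      old-path : ∀ {φ} → φ ∈ₗ vis → Star (Via (InTree (cs ∷ʳ e))) outer φ
      old-path φ∈ = Star.map (λ (d , d∈ , p , q) → d , Any.++⁺ˡ d∈ , p , q) (tree-path φ∈)
      tree-path′ : ∀ {φ} → φ ∈ₗ new ∷ vis → Star (Via (InTree (cs ∷ʳ e))) outer φ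
      tree-path′ (here refl) = old-path visited ◅◅ (e , Any.++⁺ʳ cs (here (inj₁ refl)) , refl , refl) ◅ ε
      tree-path′ (there φ∈) = old-path φ∈
      path = u ∷ interior ∷ʳ v
      vertex⇒′ : ∀ {x} → x ∈ vertices σ ⊎ x ∈ₗ path → ∃ λ φ → φ ∈ₗ new ∷ vis × x ∈ vertices (boundary φ)
      vertex⇒′ (inj₁ x∈) = let φ , φ∈ , b = vertex⇒ x∈ in φ , there φ∈ , b
      vertex⇒′ (inj₂ x∈) = new , here refl , proj₂ (proj₁ bounds) (inj₁ x∈)
      vertex⇐′ : ∀ {φ} → φ ∈ₗ new ∷ vis → ∀ {x} → x ∈ vertices (boundary φ) → x ∈ vertices σ ⊎ x ∈ₗ path
      vertex⇐′ (there φ∈) x∈ = inj₁ (vertex⇐ φ∈ x∈)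
      vertex⇐′ (here refl) x∈ with proj₁ (proj₁ bounds) x∈
      ... | inj₁ p = inj₂ p
      ... | inj₂ (here refl) = inj₂ (here refl)
      ... | inj₂ (there (here refl)) = inj₂ (there (∈-++⁺ʳ interior (here refl)))
      frontier′ : ∀ {d} → IsDart d → left d ∈ₗ new ∷ vis → ¬ left (swap d) ∈ₗ new ∷ vis →
                  ((d ∈ edges σ ⊎ Any (SameEdge d) (pairs path)) × ¬ SameEdge d e) ×
                  ((swap d ∈ edges σ ⊎ Any (SameEdge (swap d)) (pairs path)) × ¬ SameEdge (swap d) e)
      frontier′ {d} a l∈ r∉ = (proj₁ (sides l∈) , ≢e) , (proj₂ (sides l∈) , ≢e ∘ same-swapˡ)
        where
        ≢e : ¬ SameEdge d e
        ≢e (inj₁ refl) = r∉ (here refl)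
        ≢e (inj₂ refl) = r∉ (there visited)
        sides : left d ∈ₗ new ∷ vis → (d ∈ edges σ ⊎ Any (SameEdge d) (pairs path)) ×
                                      (swap d ∈ edges σ ⊎ Any (SameEdge (swap d)) (pairs path))
        sides (there p) = let x , y = frontier a p (r∉ ∘ there) in inj₁ x , inj₁ y
        -- An edge of the new face other than `e` lies on the new path.
        sides (here e≡) with proj₁ (proj₂ bounds) (a , inj₁ e≡)
        ... | inj₁ p = inj₂ p , inj₂ (Any.map same-swapˡ p)
        ... | inj₂ (here s) = ⊥-elim (≢e s)

  record Explored (σ : Subgraph) (cs : List Dart) : Set₁ where
    field
      run       : RunFrom Γ σ
      {visited} : List Face
      {final}   : Subgraph
      state     : State final visited (cs ++ chosen Γ run)
      closed    : Closed visited

  -- Each step visits a new face, so the number of faces bounds the number of steps.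
  explore : ∀ k {σ vis cs} → State σ vis cs → faces < k + length vis → Explored σ cs
  explore zero {vis = vis} S bound = ⊥-elim (ℕ.<⇒≱ bound (subst (length vis ≤_) (length-tabulate {n = faces} id)
    (unique-⊆⇒length≤ (State.vis-unique S) (λ {φ} _ → ∈-allFin φ))))
  explore (suc k) {σ} {vis} {cs} S bound
    with any? (λ u → any? λ v → chord? (u , v) ×-dec visited? (left (u , v)) ×-dec ¬? (visited? (left (v , u))))
    where
    visited? : Decidable (_∈ₗ vis)
    visited? φ = Any.any? (φ ≟_) vis
  ... | yes (u , v , c , l∈ , r∉) = record
    { run = step e e∈σ complementaryPath (Explored.run rest)
    ; state = subst (State _ _) (∷ʳ-++ cs e _) (Explored.state rest)
    ; closed = Explored.closed rest
    }
    where
    open Extend S c l∈ r∉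
    rest = explore k extended (subst (faces <_) (sym (ℕ.+-suc k _)) bound)
  ... | no none = record
    -- With no chord left to cross, σ contains every vertex, but a complementary path needs an
    -- interior vertex off σ.
    { run = stop λ e e∈ P → let x , _ , x∉ = RunCycle.some-interior cubic Γ P
                                φ , φ∈ , x∈ = closed-meets closed (State.outer∈ S) x
                            in x∉ (State.vertex⇐ S φ∈ x∈)
    ; state = subst (State σ vis) (sym (++-identityʳ cs)) S
    ; closed = closed
    }
    where
    closed : Closed vis
    closed {u , v} c l∈ = decidable-stable (Any.any? (_ ≟_) vis) λ r∉ → none (u , v , c , l∈ , r∉)

  module Tree (r : Run Γ) {vis σ} (S : State σ vis (chosen Γ r)) (closed : Closed vis) where
    open State S

    T : DualSubgraph Γ
    T = runTree Γ r

    dualVertex⇒ : ∀ {φ} → φ ∈ dualVertices T → φ ∈ₗ vis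
    dualVertex⇒ (inj₁ refl) = outer∈
    dualVertex⇒ (inj₂ p) = go tree-edge p
      where
      go : ∀ {cs φ} → (∀ {e} → e ∈ₗ cs → Chord e × left e ∈ₗ vis × left (swap e) ∈ₗ vis) →
           Any (λ e → φ ≡ left e ⊎ φ ≡ left (swap e)) cs → φ ∈ₗ vis
      go f (here (inj₁ refl)) = proj₁ (proj₂ (f (here refl)))
      go f (here (inj₂ refl)) = proj₂ (proj₂ (f (here refl)))
      go f (there p) = go (f ∘ there) p

    dualVertex⇐ : ∀ {φ} → φ ∈ₗ vis → φ ∈ dualVertices T
    dualVertex⇐ φ∈ = go (inj₁ refl) (tree-path φ∈)
      where
      go : ∀ {φ ψ} → φ ∈ dualVertices T → Star (Via (InTree (chosen Γ r))) φ ψ → ψ ∈ dualVertices T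
      go φ∈ ε = φ∈
      go _ ((d , d∈ , _ , refl) ◅ p) = go (inj₂ (Any.map (λ { (inj₁ refl) → inj₂ refl ; (inj₂ refl) → inj₁ refl }) d∈)) p

    -- The rest of a cycle leads from the right of `first` back to its left and so bypasses this
    -- chord; for a loop the rest is empty.
    acyclic : ¬ DualCycle Γ T
    acyclic Z = chord-not-bypassed (proj₁ (inTree (All.head inside)))
                  (reversed off-swap (around-cycle first others consecutive (All.tail inside) (AllPairs.head edges-distinct)))
      where
      open DualCycle Z
      off-swap : ∀ {d} → ChordOff first d → ChordOff first (swap d)
      off-swap (c , ≢first) = chord-swap c , ≢first ∘ same-swapˡ
      around-cycle : ∀ d ds → Linked (λ d e → right Γ d ≡ left e) (d ∷ ds ∷ʳ first) → All (InTree (chosen Γ r)) ds →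
                     All (λ e → ¬ SameEdge first e) ds → Star (Via (ChordOff first)) (left (swap d)) (left first)
      around-cycle d [] (e ∷ [-]) _ _ = subst (Star _ _) e ε
      around-cycle d (d′ ∷ ds) (e ∷ l) (i ∷ is) (n ∷ ns) =
        (d′ , (proj₁ (inTree i) , n ∘ same-sym) , sym e , refl) ◅ around-cycle d′ ds l is ns

    isTree : IsTreeRootedAt Γ outer T
    isTree = inj₁ refl , (λ φ∈ ψ∈ → tree-join (dualVertex⇒ φ∈) (dualVertex⇒ ψ∈)) , acyclic

    meetsEveryVertex : MeetsEveryVertex Γ T
    meetsEveryVertex v φ₁ φ₂ φ₃ corners with closed-meets closed outer∈ v
    ... | φ , φ∈ , v∈ with Equivalence.to (corners φ) v∈
    ... | here refl = inj₁ (dualVertex⇐ φ∈)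
    ... | there (here refl) = inj₂ (inj₁ (dualVertex⇐ φ∈))
    ... | there (there (here refl)) = inj₂ (inj₂ (dualVertex⇐ φ∈))

    -- An edge between visited faces is a chord; if it were not in the tree, the tree path between
    -- its sides would bypass it.
    isInduced : IsInduced Γ T
    isInduced φ ψ _ φ∈ ψ∈ u v uv refl refl = decidable-stable (Any.any? (same-edge? (u , v)) (chosen Γ r)) λ d∉ →
      chord-not-bypassed (chord-between uv (dualVertex⇒ φ∈) (dualVertex⇒ ψ∈))
        (Star.map (λ (x , x∈ , p , q) → x , (proj₁ (inTree x∈) , λ s → d∉ (Any.map (same-trans (same-sym s)) x∈)) , p , q)
          (tree-join (dualVertex⇒ φ∈) (dualVertex⇒ ψ∈)))

-- The equivalence

hamiltonian⇒tree : {G : SimpleGraph} → SimpleGraph.Cubic G → (Γ : PlaneEmbedding G) → SimpleGraph.HasHamiltonianCycle G →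
  Σ (Run Γ) λ r → IsTreeRootedAt Γ (PlaneEmbedding.outer Γ) (runTree Γ r) ×
                  MeetsEveryVertex Γ (runTree Γ r) × IsInduced Γ (runTree Γ r)
hamiltonian⇒tree {G} cubic Γ (C , ham) = run , isTree , meetsEveryVertex , isInduced
  where
  open Exploration cubic Γ (circuit G C ham)
  explored = explore (PlaneEmbedding.faces Γ) initial-state (ℕ.≤-reflexive (ℕ.+-comm 1 (PlaneEmbedding.faces Γ)))
  open Explored explored
  open Tree run state closed

theorem3p6 : (G : SimpleGraph) → SimpleGraph.Cubic G →
    (Γ : PlaneEmbedding G) → BoundedByCycle Γ (PlaneEmbedding.outer Γ) →
    SimpleGraph.HasHamiltonianCycle G ⇔
    Σ (Run Γ) (λ r →
    IsTreeRootedAt Γ (PlaneEmbedding.outer Γ) (runTree Γ r) ×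
    MeetsEveryVertex Γ (runTree Γ r) ×
    IsInduced Γ (runTree Γ r))
theorem3p6 G cubic Γ outerCycle = mk⇔ (hamiltonian⇒tree cubic Γ)
  (λ (r , _ , meets , _) → RunCycle.tree⇒hamiltonian cubic Γ outerCycle r meets)
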